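{- Let $\mathcal{P}$ be the set of integer partitions that satisfy Condition($1$) and in which $2$ does not appear as a part. Then, as formal power series in $x,q$, writing $N=i+2j+3k$, $$\sum_{\pi\in\mathcal{P}}x^{\ell(\pi)}q^{|\pi|}=\sum_{i,j,k\ge 0}\frac{x^{N+1}q^{\frac{(N+1)N}{2}+2i+j^2+2j+4k+1}+x^{N+2}q^{\frac{(N+2)(N+1)}{2}+i+j^2+2j+4k+1}+x^{N}q^{\frac{N(N-1)}{2}+3i+j^2+4j+7k}}{(q;q)_i\,(q^2;q^2)_j\,(q^3;q^3)_k}.$$
   Context: Partitions are finite weakly increasing sequences of positive integers (the empty partition is included); $\ell(\pi)$ is the number of parts and $|\pi|$ the sum of the parts of $\pi$. For a fixed integer $c$, a partition $\pi=\lambda_1+\lambda_2+\cdots+\lambda_m$ with $\lambda_1\le\lambda_2\le\cdots\le\lambda_m$ satisfies Condition($c$) if $\lambda_{s+3}-\lambda_s\ge 3$ for all $1\le s\le m-3$, and, for all $1\le s\le m-2$, if $\lambda_{s+2}-\lambda_s\le 1$ then $\lambda_s+\lambda_{s+1}+\lambda_{s+2}\equiv c\pmod 3$. For $n\ge 0$, $(a;q)_n=\prod_{0\le t<n}(1-aq^t)$. All identities are identities of formal power series. -}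

module Defs where

open import Data.Bool using (if_then_else_)
open import Data.Fin using (Fin; toℕ)
open import Data.Integer as ℤ using (ℤ; 0ℤ; 1ℤ; +_)
import Data.Integer.Divisibility as ℤ
import Data.Integer.Properties as ℤ
open import Data.List using (List; []; _∷_; foldr; length; lookup; map)
open import Data.List.Membership.Propositional using (_∉_)
open import Data.List.Relation.Unary.All using (All)
open import Data.List.Relation.Unary.Linked using (Linked)
open import Data.List.Relation.Unary.Unique.Propositional using (Unique)
open import Data.Nat using (ℕ; zero; suc; _+_; _*_; _∸_; _≤_; _≥_; _≡ᵇ_; _/_)
open import Data.Nat.ListAction using (sum)
open import Data.Product using (_×_; _,_; ∃-syntax)
open import Data.Vec using (Vec; []; _∷_; head)
open import Level using (0ℓ)
open import Relation.Binary.PropositionalEquality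
open import Relation.Unary using (Pred)

------------------------------------------------------------------------
-- Partitions

IsPartition : Pred (List ℕ) 0ℓ
IsPartition π = Linked _≤_ π × All (_≥ 1) π

-- The indices i, j, … stand for s, s+1, ….  The parts are weakly
-- increasing, so ∸ is only ever applied where it is genuine subtraction.
Condition : ℤ → Pred (List ℕ) 0ℓ
Condition c π =
    (∀ (i l : Fin (length π)) → toℕ l ≡ toℕ i + 3 →
       lookup π l ∸ lookup π i ≥ 3)
  × (∀ (i j k : Fin (length π)) → toℕ j ≡ toℕ i + 1 → toℕ k ≡ toℕ i + 2 →
       lookup π k ∸ lookup π i ≤ 1 →
       + 3 ℤ.∣ (+ (lookup π i + lookup π j + lookup π k) ℤ.- c))

𝒫 : Pred (List ℕ) 0ℓ
𝒫 π = IsPartition π × Condition 1ℤ π × 2 ∉ π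

------------------------------------------------------------------------
-- Formal power series over ℤ in q

-- f n is the coefficient of qⁿ.
ℤ⟦q⟧ : Set
ℤ⟦q⟧ = ℕ → ℤ

q^_ : ℕ → ℤ⟦q⟧
(q^ m) n = if m ≡ᵇ n then 1ℤ else 0ℤ

𝟙 : ℤ⟦q⟧
𝟙 = q^ 0

infixl 6 _⊖_
infixl 7 _⊛_
infixr 8 _^ˢ_

_⊖_ : ℤ⟦q⟧ → ℤ⟦q⟧ → ℤ⟦q⟧
(f ⊖ g) n = f n ℤ.- g n

-- Cauchy product: (f ⊛ g) n = f 0 · g n + f 1 · g (n-1) + … + f n · g 0.
_⊛_ : ℤ⟦q⟧ → ℤ⟦q⟧ → ℤ⟦q⟧
(f ⊛ g) zero    = f 0 ℤ.* g 0
(f ⊛ g) (suc n) = f 0 ℤ.* g (suc n) ℤ.+ ((λ k → f (suc k)) ⊛ g) n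

_^ˢ_ : ℤ⟦q⟧ → ℕ → ℤ⟦q⟧
f ^ˢ zero  = 𝟙
f ^ˢ suc n = f ⊛ f ^ˢ n

-- ⟨ a ⨾ b ⟩ n is (a; b)ₙ = ∏_{0 ≤ t < n} (1 - a bᵗ).
⟨_⨾_⟩_ : ℤ⟦q⟧ → ℤ⟦q⟧ → ℕ → ℤ⟦q⟧
⟨ a ⨾ b ⟩ zero  = 𝟙
⟨ a ⨾ b ⟩ suc n = (⟨ a ⨾ b ⟩ n) ⊛ (𝟙 ⊖ a ⊛ b ^ˢ n)

-- dot f (gₙ ∷ … ∷ g₀ ∷ []) = f 0 · gₙ + … + f n · g₀
dot : ∀ {n} → ℤ⟦q⟧ → Vec ℤ (suc n) → ℤ
dot f (x ∷ [])         = f 0 ℤ.* x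
dot f (x ∷ xs@(_ ∷ _)) = f 0 ℤ.* x ℤ.+ dot (λ k → f (suc k)) xs

-- The reciprocal of a series with constant term 1 (junk otherwise), from
-- the recurrence g₀ = 1, gₙ₊₁ = - (f₁ gₙ + … + fₙ₊₁ g₀).
-- recipPrefix f n lists gₙ, …, g₀.
recipPrefix : ℤ⟦q⟧ → (n : ℕ) → Vec ℤ (suc n)
recipPrefix f zero    = 1ℤ ∷ []
recipPrefix f (suc n) =
  ℤ.- dot (λ k → f (suc k)) (recipPrefix f n) ∷ recipPrefix f n

recip : ℤ⟦q⟧ → ℤ⟦q⟧
recip f n = head (recipPrefix f n)

dot-recipPrefix : ∀ g f n → dot g (recipPrefix f n) ≡ (g ⊛ recip f) n
dot-recipPrefix g f zero          = refl
dot-recipPrefix g f (suc zero)    = refl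
dot-recipPrefix g f (suc (suc n)) =
  cong (ℤ._+_ (g 0 ℤ.* recip f (suc (suc n))))
       (dot-recipPrefix (λ k → g (suc k)) f (suc n))

⊛-recip : ∀ f → f 0 ≡ 1ℤ → ∀ n → (f ⊛ recip f) n ≡ 𝟙 n
⊛-recip f f₀≡1 zero    rewrite f₀≡1 = refl
⊛-recip f f₀≡1 (suc n)
  rewrite f₀≡1
        | dot-recipPrefix (λ k → f (suc k)) f n
        | ℤ.*-identityˡ (ℤ.- ((λ k → f (suc k)) ⊛ recip f) n)
        = ℤ.+-inverseˡ (((λ k → f (suc k)) ⊛ recip f) n)

⨾-constant : ∀ a b → a 0 ≡ 0ℤ → ∀ n → (⟨ a ⨾ b ⟩ n) 0 ≡ 1ℤ
⨾-constant a b a₀≡0 zero    = refl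
⨾-constant a b a₀≡0 (suc n)
  rewrite ⨾-constant a b a₀≡0 n | a₀≡0 = refl

------------------------------------------------------------------------
-- Formal power series over ℤ in x and q

-- F m n is the coefficient of xᵐ qⁿ.
ℤ⟦x,q⟧ : Set
ℤ⟦x,q⟧ = ℕ → ℤ⟦q⟧

infixl 6 _⊞_
infixl 7 _⊘_
infix  8 x^_q^_

x^_q^_ : ℕ → ℕ → ℤ⟦x,q⟧
(x^ a q^ b) m = if a ≡ᵇ m then q^ b else (λ _ → 0ℤ)

_⊞_ : ℤ⟦x,q⟧ → ℤ⟦x,q⟧ → ℤ⟦x,q⟧
(F ⊞ G) m n = F m n ℤ.+ G m n

-- Division by a series in q alone with constant term 1.
_⊘_ : ℤ⟦x,q⟧ → ℤ⟦q⟧ → ℤ⟦x,q⟧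
(F ⊘ d) m = F m ⊛ recip d

sumℤ : List ℤ → ℤ
sumℤ = foldr ℤ._+_ 0ℤ

-- HasSum P F S: the family of the F i, over the indices i satisfying P, is
-- summable with sum S, i.e. for every monomial only finitely many members
-- have a nonzero coefficient, and these add up to the coefficient in S.
HasSum : {I : Set} → Pred I 0ℓ → (I → ℤ⟦x,q⟧) → ℤ⟦x,q⟧ → Set
HasSum {I} P F S = ∀ m n → ∃[ is ]
  ( Unique is
  × All P is
  × (∀ i → P i → i ∉ is → F i m n ≡ 0ℤ)
  × sumℤ (map (λ i → F i m n) is) ≡ S m n )

------------------------------------------------------------------------
-- The summands of the two sides

partitionTerm : List ℕ → ℤ⟦x,q⟧
partitionTerm π = x^ length π q^ sum π

tripleTerm : ℕ × ℕ × ℕ → ℤ⟦x,q⟧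
tripleTerm (i , j , k) =
  ( x^ N + 1 q^ ((N + 1) * N / 2 + 2 * i + j * j + 2 * j + 4 * k + 1)
  ⊞ x^ N + 2 q^ ((N + 2) * (N + 1) / 2 + i + j * j + 2 * j + 4 * k + 1)
  ⊞ x^ N     q^ (N * (N ∸ 1) / 2 + 3 * i + j * j + 4 * j + 7 * k) )
  ⊘ ((⟨ q^ 1 ⨾ q^ 1 ⟩ i) ⊛ (⟨ q^ 2 ⨾ q^ 2 ⟩ j) ⊛ (⟨ q^ 3 ⨾ q^ 3 ⟩ k))
  where
  N : ℕ
  N = i + 2 * j + 3 * k

{-# OPTIONS --safe #-}

-- Let B(x) be the generating function of all partitions satisfying
-- Condition(1), and C(x) that of those in which 1 occurs at most once.
-- Condition(1) forbids a part occurring three times and the pattern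
-- a, a+1, a+1.  Removing small parts and subtracting a constant from the rest
-- therefore gives
--   B(x) = C(x) + x²q² C(xq²) + x³q⁴ B(xq³)    (1+1 does not occur / 1+1 without 2 / 1+1+2)
--   C(x) = B(xq) + xq C(xq)                    (1 does not occur / 1 occurs)
-- and the generating function of the theorem is
--   B(xq²) + xq B(xq²) + x²q² C(xq²).
-- With N = i + 2j + 3k, these equations, which determine B and C, are solved by
--   B(x) = Σ x^N q^(N(N-1)/2 + i + j² + k)       / ((q;q)ᵢ (q²;q²)ⱼ (q³;q³)ₖ)
--   C(x) = Σ x^N q^(N(N-1)/2 + i + j² + 2j + 4k) / ((q;q)ᵢ (q²;q²)ⱼ (q³;q³)ₖ),
-- because 1/(q;q)ᵢ = 1/(q;q)ᵢ₋₁ + qⁱ/(q;q)ᵢ, and likewise for j and k.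

module Submission where

open import Defs
open import Algebra using (CommutativeSemigroup)
import Algebra.Properties.CommutativeSemigroup as CommutativeSemigroupProperties
open import Data.Fin using (Fin; zero; suc; toℕ)
open import Data.Integer as ℤ using (ℤ; 0ℤ; 1ℤ)
import Data.Integer.Divisibility as ℤ
import Data.Integer.Properties as ℤ
import Data.Integer.Tactic.RingSolver as ℤ-Solver
open import Data.List
  using (List; []; _∷_; _++_; map; filter; upTo; cartesianProduct; length; lookup)
open import Data.List.Membership.Propositional using (_∈_; _∉_)
open import Data.List.Membership.Propositional.Properties
  using (∈-∃++; ∈-++⁺ˡ; ∈-++⁺ʳ; ∈-++⁻; ∈-map⁺; ∈-map⁻; ∈-filter⁺; ∈-filter⁻;
         ∈-cartesianProduct⁺; ∈-upTo⁺)
import Data.List.Properties as List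
open import Data.List.Relation.Binary.Permutation.Propositional as ↭ using (_↭_; ↭-sym)
open import Data.List.Relation.Binary.Permutation.Propositional.Properties
  using (∈-resp-↭) renaming (shift to ↭-shift)
import Data.List.Relation.Binary.Permutation.Setoid.Properties as ↭-Setoid
open import Data.List.Relation.Unary.All as All using (All; []; _∷_)
import Data.List.Relation.Unary.All.Properties as All
open import Data.List.Relation.Unary.AllPairs using ([]; _∷_)
open import Data.List.Relation.Unary.Any using (here; there)
open import Data.List.Relation.Unary.Linked using (Linked; []; [-]; _∷_)
open import Data.List.Relation.Unary.Unique.Propositional using (Unique)
import Data.List.Relation.Unary.Unique.Propositional.Properties as Unique
open import Data.Nat
  using (ℕ; zero; suc; _+_; _*_; _∸_; _≤_; _<_; _≥_; z≤n; s≤s; s≤s⁻¹; z<s; s<s; _/_)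
open import Data.Nat.Divisibility using (_∣_; ∣m+n∣m⇒∣n; m∣m*n; >⇒∤)
open import Data.Nat.DivMod using (m*n/n≡m)
open import Data.Nat.Induction using (<-rec)
open import Data.Nat.ListAction using (sum)
open import Data.Nat.ListAction.Properties using (sum-++)
import Data.Nat.Properties as ℕ
import Data.Nat.Tactic.RingSolver as ℕ-Solver
open import Data.Product using (_×_; _,_; proj₁; proj₂; ∃-syntax)
open import Data.Sum using (_⊎_; inj₁; inj₂)
open import Data.Unit using (⊤; tt)
open import Function using (_∘_)
open import Level using (0ℓ)
open import Relation.Binary.PropositionalEquality
open import Relation.Nullary using (¬_; yes; no; contradiction)
open import Relation.Nullary.Decidable using (dec-true; dec-false)
open import Relation.Unary using (U)

private variable
  A : Set

-- Power series in q

infix 4 _≈_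
_≈_ : ℤ⟦q⟧ → ℤ⟦q⟧ → Set
f ≈ g = ∀ n → f n ≡ g n

⊛-cong : ∀ {f f′ g g′} → f ≈ f′ → g ≈ g′ → f ⊛ g ≈ f′ ⊛ g′
⊛-cong p r zero    = cong₂ ℤ._*_ (p 0) (r 0)
⊛-cong p r (suc n) =
  cong₂ ℤ._+_ (cong₂ ℤ._*_ (p 0) (r (suc n))) (⊛-cong (λ k → p (suc k)) r n)

⊛-zeroˡ : ∀ g → (λ _ → 0ℤ) ⊛ g ≈ λ _ → 0ℤ
⊛-zeroˡ g zero    = refl
⊛-zeroˡ g (suc n) = trans (ℤ.+-identityˡ _) (⊛-zeroˡ g n)

⊛-distribʳ-+ : ∀ f g h n → ((λ k → f k ℤ.+ g k) ⊛ h) n ≡ (f ⊛ h) n ℤ.+ (g ⊛ h) n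
⊛-distribʳ-+ f g h zero    = ℤ.*-distribʳ-+ (h 0) (f 0) (g 0)
⊛-distribʳ-+ f g h (suc n) =
  trans (cong (ℤ._+_ ((f 0 ℤ.+ g 0) ℤ.* h (suc n)))
              (⊛-distribʳ-+ (λ k → f (suc k)) (λ k → g (suc k)) h n))
        (rearrange (f 0) (g 0) (h (suc n)) _ _)
  where
  rearrange : ∀ a b c d e →
    (a ℤ.+ b) ℤ.* c ℤ.+ (d ℤ.+ e) ≡ (a ℤ.* c ℤ.+ d) ℤ.+ (b ℤ.* c ℤ.+ e)
  rearrange = ℤ-Solver.solve-∀

⊛-distribʳ-⊖ : ∀ f g h → (f ⊖ g) ⊛ h ≈ f ⊛ h ⊖ g ⊛ h
⊛-distribʳ-⊖ f g h zero    = *-distribʳ-- (f 0) (g 0) (h 0)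
  where
  *-distribʳ-- : ∀ a b c → (a ℤ.- b) ℤ.* c ≡ a ℤ.* c ℤ.- b ℤ.* c
  *-distribʳ-- = ℤ-Solver.solve-∀
⊛-distribʳ-⊖ f g h (suc n) =
  trans (cong (ℤ._+_ ((f 0 ℤ.- g 0) ℤ.* h (suc n)))
              (⊛-distribʳ-⊖ (λ k → f (suc k)) (λ k → g (suc k)) h n))
        (rearrange (f 0) (g 0) (h (suc n)) _ _)
  where
  rearrange : ∀ a b c d e →
    (a ℤ.- b) ℤ.* c ℤ.+ (d ℤ.- e) ≡ (a ℤ.* c ℤ.+ d) ℤ.- (b ℤ.* c ℤ.+ e)
  rearrange = ℤ-Solver.solve-∀

⊛-scalarˡ : ∀ a f g n → ((λ k → a ℤ.* f k) ⊛ g) n ≡ a ℤ.* (f ⊛ g) n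
⊛-scalarˡ a f g zero    = ℤ.*-assoc a (f 0) (g 0)
⊛-scalarˡ a f g (suc n) =
  trans (cong (ℤ._+_ (a ℤ.* f 0 ℤ.* g (suc n))) (⊛-scalarˡ a (λ k → f (suc k)) g n))
        (rearrange a (f 0) (g (suc n)) _)
  where
  rearrange : ∀ a b c d → a ℤ.* b ℤ.* c ℤ.+ a ℤ.* d ≡ a ℤ.* (b ℤ.* c ℤ.+ d)
  rearrange = ℤ-Solver.solve-∀

⊛-assoc : ∀ f g h → (f ⊛ g) ⊛ h ≈ f ⊛ (g ⊛ h)
⊛-assoc f g h zero    = ℤ.*-assoc (f 0) (g 0) (h 0)
⊛-assoc f g h (suc n) = begin
  f 0 ℤ.* g 0 ℤ.* h (suc n)
    ℤ.+ ((λ k → f 0 ℤ.* g (suc k) ℤ.+ (f⁺ ⊛ g) k) ⊛ h) n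
    ≡⟨ cong (ℤ._+_ (f 0 ℤ.* g 0 ℤ.* h (suc n)))
            (⊛-distribʳ-+ (λ k → f 0 ℤ.* g⁺ k) (f⁺ ⊛ g) h n) ⟩
  f 0 ℤ.* g 0 ℤ.* h (suc n)
    ℤ.+ (((λ k → f 0 ℤ.* g⁺ k) ⊛ h) n ℤ.+ ((f⁺ ⊛ g) ⊛ h) n)
    ≡⟨ cong (ℤ._+_ (f 0 ℤ.* g 0 ℤ.* h (suc n)))
            (cong₂ ℤ._+_ (⊛-scalarˡ (f 0) g⁺ h n) (⊛-assoc f⁺ g h n)) ⟩
  f 0 ℤ.* g 0 ℤ.* h (suc n)
    ℤ.+ (f 0 ℤ.* (g⁺ ⊛ h) n ℤ.+ (f⁺ ⊛ (g ⊛ h)) n)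
    ≡⟨ rearrange (f 0) (g 0) (h (suc n)) _ _ ⟩
  f 0 ℤ.* (g 0 ℤ.* h (suc n) ℤ.+ (g⁺ ⊛ h) n) ℤ.+ (f⁺ ⊛ (g ⊛ h)) n ∎
  where
  open ≡-Reasoning
  f⁺ g⁺ : ℤ⟦q⟧
  f⁺ k = f (suc k)
  g⁺ k = g (suc k)
  rearrange : ∀ a b c d e →
    a ℤ.* b ℤ.* c ℤ.+ (a ℤ.* d ℤ.+ e) ≡ a ℤ.* (b ℤ.* c ℤ.+ d) ℤ.+ e
  rearrange = ℤ-Solver.solve-∀

-- The Cauchy product is defined by recursion on its left factor. This mirror image, peeling the
-- right factor, is what lets the induction for commutativity close.
⊛-suc : ∀ f g n → (f ⊛ g) (suc n) ≡ (f ⊛ λ k → g (suc k)) n ℤ.+ f (suc n) ℤ.* g 0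
⊛-suc f g zero    = refl
⊛-suc f g (suc n) =
  trans (cong (ℤ._+_ (f 0 ℤ.* g (suc (suc n)))) (⊛-suc (λ k → f (suc k)) g n))
        (sym (ℤ.+-assoc (f 0 ℤ.* g (suc (suc n))) _ _))

⊛-comm : ∀ f g → f ⊛ g ≈ g ⊛ f
⊛-comm f g zero    = ℤ.*-comm (f 0) (g 0)
⊛-comm f g (suc n) = begin
  f 0 ℤ.* g (suc n) ℤ.+ ((λ k → f (suc k)) ⊛ g) n
    ≡⟨ cong₂ ℤ._+_ (ℤ.*-comm (f 0) (g (suc n))) (⊛-comm (λ k → f (suc k)) g n) ⟩
  g (suc n) ℤ.* f 0 ℤ.+ (g ⊛ λ k → f (suc k)) n
    ≡⟨ ℤ.+-comm (g (suc n) ℤ.* f 0) _ ⟩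
  (g ⊛ λ k → f (suc k)) n ℤ.+ g (suc n) ℤ.* f 0
    ≡⟨ ⊛-suc g f n ⟨
  (g ⊛ f) (suc n) ∎
  where open ≡-Reasoning

⊛-commutativeSemigroup : CommutativeSemigroup 0ℓ 0ℓ
⊛-commutativeSemigroup = record
  { Carrier = ℤ⟦q⟧
  ; _≈_ = _≈_
  ; _∙_ = _⊛_
  ; isCommutativeSemigroup = record
    { isSemigroup = record
      { isMagma = record
        { isEquivalence = record
          { refl  = λ _ → refl
          ; sym   = λ p n → sym (p n)
          ; trans = λ p r n → trans (p n) (r n)
          }
        ; ∙-cong = ⊛-cong
        }
      ; assoc = ⊛-assoc
      }
    ; comm = ⊛-comm
    }
  }

open CommutativeSemigroup ⊛-commutativeSemigroup
  using () renaming (setoid to ⊛-setoid; ∙-congʳ to ⊛-congʳ; ∙-congˡ to ⊛-congˡ)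
open CommutativeSemigroupProperties ⊛-commutativeSemigroup using (xy∙z≈xz∙y)

-- shift e f is q^e f, and likewise for any other grading variable.
shift : ℕ → (ℕ → ℤ) → ℕ → ℤ
shift zero    f n       = f n
shift (suc e) f zero    = 0ℤ
shift (suc e) f (suc n) = shift e f n

q^-⊛ : ∀ e f → (q^ e) ⊛ f ≈ shift e f
q^-⊛ zero    f zero    = ℤ.*-identityˡ (f 0)
q^-⊛ zero    f (suc n) =
  trans (cong₂ ℤ._+_ (ℤ.*-identityˡ (f (suc n))) (⊛-zeroˡ f n)) (ℤ.+-identityʳ _)
q^-⊛ (suc e) f zero    = refl
q^-⊛ (suc e) f (suc n) = trans (ℤ.+-identityˡ _) (q^-⊛ e f n)

shift-cong : ∀ e {f g} → f ≈ g → shift e f ≈ shift e g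
shift-cong zero    p n       = p n
shift-cong (suc e) p zero    = refl
shift-cong (suc e) p (suc n) = shift-cong e p n

shift-+ : ∀ e f g n → shift e (λ k → f k ℤ.+ g k) n ≡ shift e f n ℤ.+ shift e g n
shift-+ zero    f g n       = refl
shift-+ (suc e) f g zero    = refl
shift-+ (suc e) f g (suc n) = shift-+ e f g n

shift-0 : ∀ e n → shift e (λ _ → 0ℤ) n ≡ 0ℤ
shift-0 zero    n       = refl
shift-0 (suc e) zero    = refl
shift-0 (suc e) (suc n) = shift-0 e n

shift-shift : ∀ a b f → shift a (shift b f) ≈ shift (a + b) f
shift-shift zero    b f n       = refl
shift-shift (suc a) b f zero    = refl
shift-shift (suc a) b f (suc n) = shift-shift a b f n

-- Lets a shift be recognised from its values at `e + n` and its vanishing below `e`, with no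
-- subtraction of indices.
shift-unique : ∀ e {f g : ℕ → ℤ} → (∀ n → f (e + n) ≡ g n) →
               (∀ n → n < e → f n ≡ 0ℤ) → f ≈ shift e g
shift-unique zero    p z n       = p n
shift-unique (suc e) p z zero    = z zero z<s
shift-unique (suc e) {f} p z (suc n) =
  shift-unique e {λ k → f (suc k)} p (λ k k<e → z (suc k) (s<s k<e)) n

shift-q^ : ∀ a b → shift a (q^ b) ≈ q^ (a + b)
shift-q^ zero    b n       = refl
shift-q^ (suc a) b zero    = refl
shift-q^ (suc a) b (suc n) = shift-q^ a b n

q^-^ˢ : ∀ b n → (q^ b) ^ˢ n ≈ q^ (n * b)
q^-^ˢ b zero    m = refl
q^-^ˢ b (suc n) m = trans (⊛-congˡ {q^ b} (q^-^ˢ b n) m)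
                   (trans (q^-⊛ b (q^ (n * b)) m) (shift-q^ b (n * b) m))

-- Reciprocals of the denominators

factor : ℕ → ℕ → ℤ⟦q⟧
factor b n = 𝟙 ⊖ (q^ b) ⊛ (q^ b) ^ˢ n

factor-⊛ : ∀ b n f → factor b n ⊛ f ≈ f ⊖ shift (suc n * b) f
factor-⊛ b n f m = trans (⊛-distribʳ-⊖ 𝟙 ((q^ b) ⊛ (q^ b) ^ˢ n) f m)
  (cong₂ ℤ._-_ (q^-⊛ 0 f m)
    (trans (⊛-congʳ {f} (q^-^ˢ b (suc n)) m) (q^-⊛ (suc n * b) f m)))

recip-unique : ∀ f g → f 0 ≡ 1ℤ → f ⊛ g ≈ 𝟙 → recip f ≈ g
recip-unique f g f₀ fg≈𝟙 = begin
  recip f            ≈⟨ (λ n → sym (q^-⊛ 0 (recip f) n)) ⟩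
  𝟙 ⊛ recip f        ≈⟨ ⊛-congʳ fg≈𝟙 ⟨
  f ⊛ g ⊛ recip f    ≈⟨ xy∙z≈xz∙y f g (recip f) ⟩
  f ⊛ recip f ⊛ g    ≈⟨ ⊛-congʳ (⊛-recip f f₀) ⟩
  𝟙 ⊛ g              ≈⟨ q^-⊛ 0 g ⟩
  g                  ∎
  where open import Relation.Binary.Reasoning.Setoid ⊛-setoid

-- With s = (n+1)b, multiplying 1/f′ by 1 - q^s gives 1/f, by uniqueness of the reciprocal; hence
-- 1/f′ = 1/f + q^s/f′. This is the source of all recurrences below.
recip-factor : ∀ b n f f′ → f 0 ≡ 1ℤ → f′ 0 ≡ 1ℤ → f′ ≈ f ⊛ factor b n →
  ∀ m → recip f′ m ≡ recip f m ℤ.+ shift (suc n * b) (recip f′) m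
recip-factor b n f f′ f₀ f′₀ f′≈ m = begin
  recip f′ m
    ≡⟨ cancel (recip f′ m) _ ⟩
  recip f′ m ℤ.- s ℤ.+ s
    ≡⟨ cong (ℤ._+ s) (factor-⊛ b n (recip f′) m) ⟨
  (factor b n ⊛ recip f′) m ℤ.+ s
    ≡⟨ cong (ℤ._+ s) (recip-unique f _ f₀ inverse m) ⟨
  recip f m ℤ.+ s ∎
  where
  open ≡-Reasoning
  s = shift (suc n * b) (recip f′) m
  cancel : ∀ x y → x ≡ x ℤ.- y ℤ.+ y
  cancel = ℤ-Solver.solve-∀
  inverse : f ⊛ (factor b n ⊛ recip f′) ≈ 𝟙
  inverse k = trans (sym (⊛-assoc f (factor b n) (recip f′) k))
             (trans (⊛-congʳ {recip f′} (λ l → sym (f′≈ l)) k) (⊛-recip f′ f′₀ k))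

Triple : Set
Triple = ℕ × ℕ × ℕ

denominator : Triple → ℤ⟦q⟧
denominator (i , j , k) =
  (⟨ q^ 1 ⨾ q^ 1 ⟩ i) ⊛ (⟨ q^ 2 ⨾ q^ 2 ⟩ j) ⊛ (⟨ q^ 3 ⨾ q^ 3 ⟩ k)

R : Triple → ℤ⟦q⟧
R t = recip (denominator t)

denominator-constant : ∀ t → denominator t 0 ≡ 1ℤ
denominator-constant (i , j , k)
  rewrite ⨾-constant (q^ 1) (q^ 1) refl i
        | ⨾-constant (q^ 2) (q^ 2) refl j
        | ⨾-constant (q^ 3) (q^ 3) refl k = refl

-- The new factor sits inside the first of the three products, so commutativity has to carry it to
-- the right end, where `recip-factor` expects it.
R-suc₁ : ∀ i j k n →
  R (suc i , j , k) n ≡ R (i , j , k) n ℤ.+ shift (suc i * 1) (R (suc i , j , k)) n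
R-suc₁ i j k = recip-factor 1 i (denominator (i , j , k)) (denominator (suc i , j , k))
  (denominator-constant (i , j , k)) (denominator-constant (suc i , j , k)) (λ n →
    trans (⊛-congʳ {c} (xy∙z≈xz∙y a u b) n) (xy∙z≈xz∙y (a ⊛ b) u c n))
  where
  a = ⟨ q^ 1 ⨾ q^ 1 ⟩ i
  b = ⟨ q^ 2 ⨾ q^ 2 ⟩ j
  c = ⟨ q^ 3 ⨾ q^ 3 ⟩ k
  u = factor 1 i

R-suc₂ : ∀ i j k n →
  R (i , suc j , k) n ≡ R (i , j , k) n ℤ.+ shift (suc j * 2) (R (i , suc j , k)) n
R-suc₂ i j k = recip-factor 2 j (denominator (i , j , k)) (denominator (i , suc j , k))
  (denominator-constant (i , j , k)) (denominator-constant (i , suc j , k)) (λ n →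
    trans (⊛-congʳ {c} (λ m → sym (⊛-assoc a b u m)) n) (xy∙z≈xz∙y (a ⊛ b) u c n))
  where
  a = ⟨ q^ 1 ⨾ q^ 1 ⟩ i
  b = ⟨ q^ 2 ⨾ q^ 2 ⟩ j
  c = ⟨ q^ 3 ⨾ q^ 3 ⟩ k
  u = factor 2 j

R-suc₃ : ∀ i j k n →
  R (i , j , suc k) n ≡ R (i , j , k) n ℤ.+ shift (suc k * 3) (R (i , j , suc k)) n
R-suc₃ i j k = recip-factor 3 k (denominator (i , j , k)) (denominator (i , j , suc k))
  (denominator-constant (i , j , k)) (denominator-constant (i , j , suc k)) (λ n →
    sym (⊛-assoc (a ⊛ b) c u n))
  where
  a = ⟨ q^ 1 ⨾ q^ 1 ⟩ i
  b = ⟨ q^ 2 ⨾ q^ 2 ⟩ j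
  c = ⟨ q^ 3 ⨾ q^ 3 ⟩ k
  u = factor 3 k

R-000 : R (0 , 0 , 0) ≈ 𝟙
R-000 = recip-unique (denominator (0 , 0 , 0)) 𝟙 refl (λ n →
  trans (⊛-congʳ {𝟙} (⊛-congʳ {𝟙} (q^-⊛ 0 𝟙)) n)
  (trans (⊛-congʳ {𝟙} (q^-⊛ 0 𝟙) n) (q^-⊛ 0 𝟙 n)))

-- Sums over triples

Σℤ : List A → (A → ℤ) → ℤ
Σℤ l φ = sumℤ (map φ l)

Σ-cong : ∀ (l : List A) {φ ψ} → (∀ x → x ∈ l → φ x ≡ ψ x) → Σℤ l φ ≡ Σℤ l ψ
Σ-cong []      p = refl
Σ-cong (x ∷ l) p = cong₂ ℤ._+_ (p x (here refl)) (Σ-cong l (λ y y∈l → p y (there y∈l)))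

Σ-0 : ∀ (l : List A) → Σℤ l (λ _ → 0ℤ) ≡ 0ℤ
Σ-0 []      = refl
Σ-0 (x ∷ l) = trans (ℤ.+-identityˡ _) (Σ-0 l)

Σ-+ : ∀ (l : List A) φ ψ → Σℤ l (λ x → φ x ℤ.+ ψ x) ≡ Σℤ l φ ℤ.+ Σℤ l ψ
Σ-+ []      φ ψ = refl
Σ-+ (x ∷ l) φ ψ = trans (cong (ℤ._+_ (φ x ℤ.+ ψ x)) (Σ-+ l φ ψ)) (interchange (φ x) (ψ x) _ _)
  where
  interchange : ∀ a b c d → (a ℤ.+ b) ℤ.+ (c ℤ.+ d) ≡ (a ℤ.+ c) ℤ.+ (b ℤ.+ d)
  interchange = ℤ-Solver.solve-∀

Σ-map : ∀ {B : Set} (s : A → B) l φ → Σℤ (map s l) φ ≡ Σℤ l (φ ∘ s)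
Σ-map s l φ = cong sumℤ (sym (List.map-∘ l))

Σ-↭ : ∀ {l l′ : List A} φ → l ↭ l′ → Σℤ l φ ≡ Σℤ l′ φ
Σ-↭ φ ↭.refl         = refl
Σ-↭ φ (↭.prep x p)   = cong (ℤ._+_ (φ x)) (Σ-↭ φ p)
Σ-↭ φ (↭.swap x y p) = trans (cong (λ z → φ x ℤ.+ (φ y ℤ.+ z)) (Σ-↭ φ p)) (exchange (φ x) (φ y) _)
  where
  exchange : ∀ a b c → a ℤ.+ (b ℤ.+ c) ≡ b ℤ.+ (a ℤ.+ c)
  exchange = ℤ-Solver.solve-∀
Σ-↭ φ (↭.trans p r)  = trans (Σ-↭ φ p) (Σ-↭ φ r)

Σ-shift : ∀ (l : List A) e (f : A → ℤ⟦q⟧) n →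
          Σℤ l (λ x → shift e (f x) n) ≡ shift e (λ k → Σℤ l (λ x → f x k)) n
Σ-shift []      e f n = sym (shift-0 e n)
Σ-shift (x ∷ l) e f n =
  trans (cong (ℤ._+_ (shift e (f x) n)) (Σ-shift l e f n)) (sym (shift-+ e (f x) _ n))

-- Induction on the smaller list: its head is moved to the front of the larger one by a permutation
-- and removed from both. When the smaller list is exhausted, only zeros remain.
Σ-support : ∀ (l l′ : List A) φ → Unique l → Unique l′ → (∀ {x} → x ∈ l′ → x ∈ l) →
            (∀ x → x ∈ l → x ∉ l′ → φ x ≡ 0ℤ) → Σℤ l φ ≡ Σℤ l′ φ
Σ-support l []       φ u u′        sub z =
  trans (Σ-cong l (λ x x∈l → z x x∈l (λ ()))) (Σ-0 l)
Σ-support l (y ∷ l′) φ u (y∉ ∷ u′) sub z with ∈-∃++ (sub (here refl))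
... | as , bs , refl = trans (Σ-↭ φ p) (cong (ℤ._+_ (φ y)) (Σ-support (as ++ bs) l′ φ
        (proj₂ (uncons (↭-Setoid.Unique-resp-↭ (setoid _) (↭.↭⇒↭ₛ p) u))) u′ sub′ z′))
  where
  p : as ++ y ∷ bs ↭ y ∷ as ++ bs
  p = ↭-shift y as bs
  uncons : ∀ {x xs} → Unique (x ∷ xs) → x ∉ xs × Unique xs
  uncons (x∉ ∷ v) = All.All¬⇒¬Any x∉ , v
  sub′ : ∀ {x} → x ∈ l′ → x ∈ as ++ bs
  sub′ x∈ with ∈-resp-↭ p (sub (there x∈))
  ... | here refl = contradiction x∈ (All.All¬⇒¬Any y∉)
  ... | there x∈′ = x∈′
  z′ : ∀ x → x ∈ as ++ bs → x ∉ l′ → φ x ≡ 0ℤ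
  z′ x x∈ x∉ = z x (∈-resp-↭ (↭-sym p) (there x∈)) λ where
    (here refl) → proj₁ (uncons (↭-Setoid.Unique-resp-↭ (setoid _) (↭.↭⇒↭ₛ p) u)) x∈
    (there x∈′) → x∉ x∈′

-- Triples of a given weight

weight : Triple → ℕ
weight (i , j , k) = i + 2 * j + 3 * k

box : ℕ → List Triple
box m = cartesianProduct (upTo (suc m)) (cartesianProduct (upTo (suc m)) (upTo (suc m)))

box-unique : ∀ m → Unique (box m)
box-unique m = Unique.cartesianProduct⁺ u (Unique.cartesianProduct⁺ u u)
  where
  u : Unique (upTo (suc m))
  u = Unique.upTo⁺ (suc m)

-- Each index is at most the weight, so a cube of side `m + 1` is a finite range large enough for
-- the coefficient of x^m.
weight≤⇒∈box : ∀ {m} t → weight t ≤ m → t ∈ box m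
weight≤⇒∈box (i , j , k) w≤m =
  ∈-cartesianProduct⁺ (bound i (ℕ.≤-trans (ℕ.m≤m+n i (2 * j)) (ℕ.m≤m+n _ (3 * k))))
    (∈-cartesianProduct⁺
      (bound j (ℕ.≤-trans (ℕ.m≤n*m j 2) (ℕ.≤-trans (ℕ.m≤n+m (2 * j) i) (ℕ.m≤m+n _ (3 * k)))))
      (bound k (ℕ.≤-trans (ℕ.m≤n*m k 3) (ℕ.m≤n+m (3 * k) (i + 2 * j)))))
  where
  bound : ∀ x → x ≤ weight (i , j , k) → x ∈ upTo (suc _)
  bound x x≤w = ∈-upTo⁺ (s≤s (ℕ.≤-trans x≤w w≤m))

triples : ℕ → List Triple
triples N = filter (λ t → weight t ℕ.≟ N) (box N)

triples-unique : ∀ N → Unique (triples N)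
triples-unique N = Unique.filter⁺ (λ t → weight t ℕ.≟ N) (box-unique N)

∈triples⁺ : ∀ t {N} → weight t ≡ N → t ∈ triples N
∈triples⁺ t {N} w≡N =
  ∈-filter⁺ (λ t → weight t ℕ.≟ N) (weight≤⇒∈box t (ℕ.≤-reflexive w≡N)) w≡N

∈triples⁻ : ∀ {t N} → t ∈ triples N → weight t ≡ N
∈triples⁻ {N = N} t∈ = proj₂ (∈-filter⁻ (λ t → weight t ℕ.≟ N) {xs = box N} t∈)

W : ℕ → (Triple → ℤ) → ℤ
W N = Σℤ (triples N)

W-cong : ∀ N {φ ψ} → (∀ t → weight t ≡ N → φ t ≡ ψ t) → W N φ ≡ W N ψ
W-cong N p = Σ-cong (triples N) (λ t t∈ → p t (∈triples⁻ t∈))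

-- Treats the indices i, j, k uniformly. On a raised triple, `step` is the exponent s of the last
-- factor 1 - q^s belonging to the chosen index; it is 0 when that index is 0. Writing it as
-- `i * 1`, `j * 2`, `k * 3` makes `step (raise t)` reduce to the exponent in `R-suc₁`, `R-suc₂`,
-- `R-suc₃`.
record Raising : Set where
  field
    raise       : Triple → Triple
    raise-inj   : ∀ {t t′} → raise t ≡ raise t′ → t ≡ t′
    rise        : ℕ
    weight-rise : ∀ t → weight (raise t) ≡ rise + weight t
    step        : Triple → ℕ
    view        : ∀ t → step t ≡ 0 ⊎ ∃[ t′ ] t ≡ raise t′
    R-raise     : ∀ t n → R (raise t) n ≡ R t n ℤ.+ shift (step (raise t)) (R (raise t)) n

raise-i raise-j raise-k : Raising
raise-i = record
  { raise       = λ (i , j , k) → suc i , j , k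
  ; raise-inj   = λ { refl → refl }
  ; rise        = 1
  ; weight-rise = λ _ → refl
  ; step        = λ (i , j , k) → i * 1
  ; view        = λ { (zero , _) → inj₁ refl ; (suc i , j , k) → inj₂ ((i , j , k) , refl) }
  ; R-raise     = λ (i , j , k) → R-suc₁ i j k
  }
raise-j = record
  { raise       = λ (i , j , k) → i , suc j , k
  ; raise-inj   = λ { refl → refl }
  ; rise        = 2
  ; weight-rise = λ (i , j , k) → lemma i j k
  ; step        = λ (i , j , k) → j * 2
  ; view        = λ { (_ , zero , _) → inj₁ refl ; (i , suc j , k) → inj₂ ((i , j , k) , refl) }
  ; R-raise     = λ (i , j , k) → R-suc₂ i j k
  }
  where
  lemma : ∀ i j k → i + 2 * (1 + j) + 3 * k ≡ 2 + (i + 2 * j + 3 * k)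
  lemma = ℕ-Solver.solve-∀
raise-k = record
  { raise       = λ (i , j , k) → i , j , suc k
  ; raise-inj   = λ { refl → refl }
  ; rise        = 3
  ; weight-rise = λ (i , j , k) → lemma i j k
  ; step        = λ (i , j , k) → k * 3
  ; view        = λ { (_ , _ , zero) → inj₁ refl ; (i , j , suc k) → inj₂ ((i , j , k) , refl) }
  ; R-raise     = λ (i , j , k) → R-suc₃ i j k
  }
  where
  lemma : ∀ i j k → i + 2 * j + 3 * (1 + k) ≡ 3 + (i + 2 * j + 3 * k)
  lemma = ℕ-Solver.solve-∀

shift-cong-at : ∀ c {f g : ℕ → ℤ} N → (∀ N′ → c + N′ ≡ N → f N′ ≡ g N′) →
                shift c f N ≡ shift c g N
shift-cong-at zero    N       p = p N refl
shift-cong-at (suc c) zero    p = refl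
shift-cong-at (suc c) (suc N) p = shift-cong-at c N (λ N′ q → p N′ (cong suc q))

-- A power of q common to all terms comes out of the sum. It may depend on `N`, since the weight is
-- constant on the range; this is how substituting xq^k for x becomes visible.
W-shift : ∀ N a (e e′ : Triple → ℕ) n → (∀ t → weight t ≡ N → e t ≡ a + e′ t) →
  W N (λ t → shift (e t) (R t) n) ≡ shift a (λ m → W N (λ t → shift (e′ t) (R t) m)) n
W-shift N a e e′ n p = trans
  (W-cong N (λ t w → trans (cong (λ x → shift x (R t) n) (p t w))
                           (sym (shift-shift a (e′ t) (R t) n))))
  (Σ-shift (triples N) a (λ t → shift (e′ t) (R t)) n)

-- tri N = N (N - 1) / 2
tri : ℕ → ℕ
tri zero    = 0
tri (suc N) = N + tri N

-- The series x^(length pre) q^(sum pre) F(x q^k).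
piece : List ℕ → ℕ → ℤ⟦x,q⟧ → ℤ⟦x,q⟧
piece pre k F N n =
  shift (length pre) (λ N′ → shift (sum pre + k * N′) (F N′) n) N

module _ (ρ : Raising) where
  open Raising ρ

  -- The terms with chosen index 0 vanish and all other triples are raised ones, so the sum can be
  -- indexed by the lowered triple. Below weight `rise` there are no raised triples at all.
  W-reindex : ∀ N φ → (∀ t → step t ≡ 0 → φ t ≡ 0ℤ) →
              W N φ ≡ shift rise (λ N′ → W N′ (φ ∘ raise)) N
  W-reindex N φ z = shift-unique rise {λ N → W N φ} raised small N
    where
    raised : ∀ N → W (rise + N) φ ≡ W N (φ ∘ raise)
    raised N = trans
      (Σ-support (triples (rise + N)) (map raise (triples N)) φ (triples-unique (rise + N))
        (Unique.map⁺ raise-inj (triples-unique N)) sub rest)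
      (Σ-map raise (triples N) φ)
      where
      sub : ∀ {t} → t ∈ map raise (triples N) → t ∈ triples (rise + N)
      sub t∈ with ∈-map⁻ raise t∈
      ... | t′ , t′∈ , refl =
        ∈triples⁺ (raise t′) (trans (weight-rise t′) (cong (rise +_) (∈triples⁻ t′∈)))
      rest : ∀ t → t ∈ triples (rise + N) → t ∉ map raise (triples N) → φ t ≡ 0ℤ
      rest t t∈ t∉ with view t
      ... | inj₁ s≡0         = z t s≡0
      ... | inj₂ (t′ , refl) = contradiction
        (∈-map⁺ raise (∈triples⁺ t′ (ℕ.+-cancelˡ-≡ rise _ _
          (trans (sym (weight-rise t′)) (∈triples⁻ t∈))))) t∉
    small : ∀ N → N < rise → W N φ ≡ 0ℤ
    small N N<rise = trans (W-cong N vanish) (Σ-0 (triples N))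
      where
      vanish : ∀ t → weight t ≡ N → φ t ≡ 0ℤ
      vanish t w≡N with view t
      ... | inj₁ s≡0         = z t s≡0
      ... | inj₂ (t′ , refl) = contradiction
        (subst (rise ≤_) (trans (sym (weight-rise t′)) w≡N) (ℕ.m≤m+n rise _))
        (ℕ.<⇒≱ N<rise)

  -- With s the step, q^e splits as q^(e+s) + q^e (1 - q^s). In the second part, `φ`, the factor 1 -
  -- q^s cancels the last factor of the denominator, which lowers the index, or kills the term if
  -- the index is 0.
  W-peel : ∀ N (e e′ : Triple → ℕ) n → (∀ t → weight t ≡ N → e t + step t ≡ e′ t) →
    W N (λ t → shift (e t) (R t) n) ≡
    W N (λ t → shift (e′ t) (R t) n) ℤ.+
    shift rise (λ N′ → W N′ (λ t → shift (e (raise t)) (R t) n)) N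
  W-peel N e e′ n e+s≡e′ = begin
    W N (λ t → shift (e t) (R t) n)
      ≡⟨ W-cong N (λ t w≡N → trans (split _ (shift (e t + step t) (R t) n))
           (cong (λ x → shift x (R t) n ℤ.+ φ t) (e+s≡e′ t w≡N))) ⟩
    W N (λ t → shift (e′ t) (R t) n ℤ.+ φ t)
      ≡⟨ Σ-+ (triples N) (λ t → shift (e′ t) (R t) n) φ ⟩
    W N (λ t → shift (e′ t) (R t) n) ℤ.+ W N φ
      ≡⟨ cong (ℤ._+_ (W N (λ t → shift (e′ t) (R t) n))) (W-reindex N φ vanish) ⟩
    W N (λ t → shift (e′ t) (R t) n) ℤ.+ shift rise (λ N′ → W N′ (φ ∘ raise)) N
      ≡⟨ cong (ℤ._+_ (W N (λ t → shift (e′ t) (R t) n))) (shift-cong rise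
           (λ N′ → W-cong N′ (λ t _ → raised t)) N) ⟩
    W N (λ t → shift (e′ t) (R t) n) ℤ.+
    shift rise (λ N′ → W N′ (λ t → shift (e (raise t)) (R t) n)) N ∎
    where
    open ≡-Reasoning
    φ : Triple → ℤ
    φ t = shift (e t) (R t) n ℤ.- shift (e t + step t) (R t) n
    split : ∀ x y → x ≡ y ℤ.+ (x ℤ.- y)
    split = ℤ-Solver.solve-∀
    cancel : ∀ x y → x ℤ.+ y ℤ.- y ≡ x
    cancel = ℤ-Solver.solve-∀
    vanish : ∀ t → step t ≡ 0 → φ t ≡ 0ℤ
    vanish t s≡0 rewrite s≡0 | ℕ.+-identityʳ (e t) = ℤ.+-inverseʳ (shift (e t) (R t) n)
    raised : ∀ t → φ (raise t) ≡ shift (e (raise t)) (R t) n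
    raised t = begin
      φ (raise t)
        ≡⟨ cong (ℤ._- shift (a + s) R′ n)
             (trans (shift-cong a (R-raise t) n) (shift-+ a (R t) (shift s R′) n)) ⟩
      shift a (R t) n ℤ.+ shift a (shift s R′) n ℤ.- shift (a + s) R′ n
        ≡⟨ cong (λ x → shift a (R t) n ℤ.+ x ℤ.- shift (a + s) R′ n) (shift-shift a s R′ n) ⟩
      shift a (R t) n ℤ.+ shift (a + s) R′ n ℤ.- shift (a + s) R′ n
        ≡⟨ cancel (shift a (R t) n) _ ⟩
      shift a (R t) n ∎
      where
      a  = e (raise t)
      s  = step (raise t)
      R′ = R (raise t)

  -- Casts the second sum of `W-peel` in the shape of a combinatorial recurrence: raising the index
  -- matches prepending the small parts `pre` and adding `k` to the `N′` others.
  W-peel-piece : ∀ pre k N (e e′ e″ : Triple → ℕ) n → length pre ≡ rise →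
    (∀ t → weight t ≡ N → e t + step t ≡ e′ t) →
    (∀ N′ → rise + N′ ≡ N → ∀ t → weight t ≡ N′ →
       e (raise t) ≡ sum pre + k * N′ + (tri N′ + e″ t)) →
    W N (λ t → shift (e t) (R t) n) ≡
    W N (λ t → shift (e′ t) (R t) n) ℤ.+
    piece pre k (λ N′ m → W N′ (λ t → shift (tri N′ + e″ t) (R t) m)) N n
  W-peel-piece pre k N e e′ e″ n refl p p′ = trans (W-peel N e e′ n p)
    (cong (ℤ._+_ (W N (λ t → shift (e′ t) (R t) n))) (shift-cong-at (length pre) N
      (λ N′ c → W-shift N′ (sum pre + k * N′) (λ t → e (raise t)) (λ t → tri N′ + e″ t) n
        (p′ N′ c))))

-- The functional equations for the triple series

e₀ e₁ : Triple → ℕ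
e₀ (i , j , k) = i + j * j + k
e₁ (i , j , k) = i + j * j + 2 * j + 4 * k

B C : ℤ⟦x,q⟧
B N n = W N (λ t → shift (tri N + e₀ t) (R t) n)
C N n = W N (λ t → shift (tri N + e₁ t) (R t) n)

-- Peeling i adds i to the exponent, and `e₁ t` + i = N + `e₀ t` at weight N, which gives B(xq). In
-- the other sum `tri` grows by N′ and `e₁` by 1, which gives xq C(xq).
C-rec : ∀ N n → C N n ≡ piece [] 1 B N n ℤ.+ piece (1 ∷ []) 1 C N n
C-rec N n = trans
  (W-peel-piece raise-i (1 ∷ []) 1 N (λ t → tri N + e₁ t) (λ t → 1 * N + (tri N + e₀ t)) e₁ n refl
    (λ { (i , j , k) refl → lemma (tri N) i j k })
    (λ { N′ refl (i , j , k) refl → lemma′ (tri N′) i j k }))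
  (cong (ℤ._+ piece (1 ∷ []) 1 C N n) (W-shift N (1 * N) _ _ n (λ _ _ → refl)))
  where
  lemma : ∀ T i j k →
    T + (i + j * j + 2 * j + 4 * k) + i * 1 ≡ 1 * (i + 2 * j + 3 * k) + (T + (i + j * j + k))
  lemma = ℕ-Solver.solve-∀
  lemma′ : ∀ T i j k → (i + 2 * j + 3 * k) + T + (1 + i + j * j + 2 * j + 4 * k)
    ≡ 1 + 1 * (i + 2 * j + 3 * k) + (T + (i + j * j + 2 * j + 4 * k))
  lemma′ = ℕ-Solver.solve-∀

-- Peeling k turns k into 4k, reaching the auxiliary `e`; peeling j then turns j² into j² + 2j,
-- reaching `e₁`. The complementary sums gain 3N′ + 4 and 2N′ + 2 in the exponent, matching the
-- prefixes 1+1+2 and 1+1.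
B-rec : ∀ N n → B N n ≡
  C N n ℤ.+ piece (1 ∷ 1 ∷ []) 2 C N n ℤ.+ piece (1 ∷ 1 ∷ 2 ∷ []) 3 B N n
B-rec N n = trans
  (W-peel-piece raise-k (1 ∷ 1 ∷ 2 ∷ []) 3 N (λ t → tri N + e₀ t) e e₀ n refl
    (λ { (i , j , k) refl → lemma₁ (tri N) i j k })
    (λ { N′ refl (i , j , k) refl → lemma₂ (tri N′) i j k }))
  (cong (ℤ._+ piece (1 ∷ 1 ∷ 2 ∷ []) 3 B N n)
    (W-peel-piece raise-j (1 ∷ 1 ∷ []) 2 N e (λ t → tri N + e₁ t) e₁ n refl
      (λ { (i , j , k) refl → lemma₃ (tri N) i j k })
      (λ { N′ refl (i , j , k) refl → lemma₄ (tri N′) i j k })))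
  where
  e : Triple → ℕ
  e (i , j , k) = tri N + (i + j * j + 4 * k)
  lemma₁ : ∀ T i j k → T + (i + j * j + k) + k * 3 ≡ T + (i + j * j + 4 * k)
  lemma₁ = ℕ-Solver.solve-∀
  lemma₂ : ∀ T i j k (let w = i + 2 * j + 3 * k) →
    (2 + w) + ((1 + w) + (w + T)) + (i + j * j + (1 + k)) ≡ 4 + 3 * w + (T + (i + j * j + k))
  lemma₂ = ℕ-Solver.solve-∀
  lemma₃ : ∀ T i j k → T + (i + j * j + 4 * k) + j * 2 ≡ T + (i + j * j + 2 * j + 4 * k)
  lemma₃ = ℕ-Solver.solve-∀
  lemma₄ : ∀ T i j k (let w = i + 2 * j + 3 * k) →
    ((1 + w) + (w + T)) + (i + (1 + j) * (1 + j) + 4 * k) ≡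
    2 + 2 * w + (T + (i + j * j + 2 * j + 4 * k))
  lemma₄ = ℕ-Solver.solve-∀

-- `triples 0` computes to the single triple of zeros, whose exponent is 0.
BC-0 : ∀ n → B 0 n ≡ 𝟙 n × C 0 n ≡ 𝟙 n
BC-0 n = trans (ℤ.+-identityʳ _) (R-000 n) , trans (ℤ.+-identityʳ _) (R-000 n)

-- The triple sum of the theorem

x^q^-≡ : ∀ a b f n → ((x^ a q^ b) a ⊛ f) n ≡ shift b f n
x^q^-≡ a b f n rewrite dec-true (a ℕ.≟ a) refl = q^-⊛ b f n

x^q^-≢ : ∀ a b m f n → a ≢ m → ((x^ a q^ b) m ⊛ f) n ≡ 0ℤ
x^q^-≢ a b m f n a≢m rewrite dec-false (a ℕ.≟ m) a≢m = ⊛-zeroˡ f n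

monomialTerm : ℕ → (Triple → ℕ) → Triple → ℤ⟦x,q⟧
monomialTerm c e t = (x^ (c + weight t) q^ (e t)) ⊘ denominator t

-- In the coefficient of x^m only triples with `c + weight t` equal to m survive, so summing over
-- the box amounts to summing over one weight, and gives 0 if m < c.
Σ-monomialTerm : ∀ c (e : Triple → ℕ) m n →
  Σℤ (box m) (λ t → monomialTerm c e t m n) ≡
  shift c (λ N → W N (λ t → shift (e t) (R t) n)) m
Σ-monomialTerm c e m n =
  shift-unique c {λ m → Σℤ (box m) (λ t → monomialTerm c e t m n)} large small m
  where
  large : ∀ N → Σℤ (box (c + N)) (λ t → monomialTerm c e t (c + N) n) ≡
                W N (λ t → shift (e t) (R t) n)
  large N = trans
    (Σ-support (box (c + N)) (triples N) _ (box-unique (c + N)) (triples-unique N)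
      (λ {t} t∈ → weight≤⇒∈box t (subst (_≤ c + N) (sym (∈triples⁻ t∈)) (ℕ.m≤n+m N c)))
      (λ t _ t∉ → x^q^-≢ (c + weight t) (e t) (c + N) (R t) n
        (λ w≡ → t∉ (∈triples⁺ t (ℕ.+-cancelˡ-≡ c _ _ w≡)))))
    (W-cong N (λ t w≡N → subst (λ x → monomialTerm c e t (c + x) n ≡ shift (e t) (R t) n) w≡N
      (x^q^-≡ (c + weight t) (e t) (R t) n)))
  small : ∀ m → m < c → Σℤ (box m) (λ t → monomialTerm c e t m n) ≡ 0ℤ
  small m m<c = trans
    (Σ-cong (box m) (λ t _ → x^q^-≢ (c + weight t) (e t) m (R t) n
      (λ w≡m → ℕ.<⇒≱ m<c (subst (c ≤_) w≡m (ℕ.m≤m+n c (weight t))))))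
    (Σ-0 (box m))

-- The exponents of the three numerators, regrouped to exhibit xq B(xq²), x²q² C(xq²) and B(xq²);
-- the summand `2 * weight t` comes from substituting xq² for x.
E₁ E₂ E₃ : Triple → ℕ
E₁ t = 1 + 2 * weight t + (tri (weight t) + e₀ t)
E₂ t = 2 + 2 * weight t + (tri (weight t) + e₁ t)
E₃ t = 2 * weight t + (tri (weight t) + e₀ t)

-- The induction is carried out on the doubled identity, so that division by 2 happens once, on a
-- visible multiple of 2.
tri-half : ∀ N → suc N * N / 2 ≡ tri (suc N)
tri-half N = trans (cong (_/ 2) (double N)) (m*n/n≡m (tri (suc N)) 2)
  where
  rearrange : ∀ N T → 2 * (1 + N) + T * 2 ≡ (1 + N + T) * 2
  rearrange = ℕ-Solver.solve-∀
  unfold : ∀ N → (2 + N) * (1 + N) ≡ 2 * (1 + N) + (1 + N) * N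
  unfold = ℕ-Solver.solve-∀
  double : ∀ N → suc N * N ≡ tri (suc N) * 2
  double zero    = refl
  double (suc N) = trans (unfold N)
    (trans (cong (2 * (1 + N) +_) (double N)) (rearrange N (tri (suc N))))

tripleTerm-split : ∀ t m n → tripleTerm t m n ≡
  monomialTerm 1 E₁ t m n ℤ.+ monomialTerm 2 E₂ t m n ℤ.+ monomialTerm 0 E₃ t m n
tripleTerm-split t@(i , j , k) m n = trans (⊛-distribʳ-+ (λ r → F₁ r ℤ.+ F₂ r) F₃ (R t) n)
  (cong₂ ℤ._+_ (trans (⊛-distribʳ-+ F₁ F₂ (R t) n)
    (cong₂ ℤ._+_
      (cong₂ (λ a b → ((x^ a q^ b) m ⊛ R t) n) (ℕ.+-comm w 1) exp₁)
      (cong₂ (λ a b → ((x^ a q^ b) m ⊛ R t) n) (ℕ.+-comm w 2) exp₂)))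
    (cong (λ b → ((x^ w q^ b) m ⊛ R t) n) exp₃))
  where
  w = weight t
  F₁ = (x^ w + 1 q^ ((w + 1) * w / 2 + 2 * i + j * j + 2 * j + 4 * k + 1)) m
  F₂ = (x^ w + 2 q^ ((w + 2) * (w + 1) / 2 + i + j * j + 2 * j + 4 * k + 1)) m
  F₃ = (x^ w q^ (w * (w ∸ 1) / 2 + 3 * i + j * j + 4 * j + 7 * k)) m
  lemma₁ : ∀ T i j k (let w = i + 2 * j + 3 * k) →
    w + T + 2 * i + j * j + 2 * j + 4 * k + 1 ≡ 1 + 2 * w + (T + (i + j * j + k))
  lemma₁ = ℕ-Solver.solve-∀
  lemma₂ : ∀ T i j k (let w = i + 2 * j + 3 * k) →
    1 + w + (w + T) + i + j * j + 2 * j + 4 * k + 1 ≡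
    2 + 2 * w + (T + (i + j * j + 2 * j + 4 * k))
  lemma₂ = ℕ-Solver.solve-∀
  lemma₃ : ∀ T i j k (let w = i + 2 * j + 3 * k) →
    T + 3 * i + j * j + 4 * j + 7 * k ≡ 2 * w + (T + (i + j * j + k))
  lemma₃ = ℕ-Solver.solve-∀
  half₀ : ∀ w → w * (w ∸ 1) / 2 ≡ tri w
  -- The truncation in `w ∸ 1` at w = 0 does no harm, as the product is 0.
  half₀ zero    = refl
  half₀ (suc w) = tri-half w
  half₁ : (w + 1) * w / 2 ≡ tri (suc w)
  half₁ = trans (cong (λ x → x * w / 2) (ℕ.+-comm w 1)) (tri-half w)
  half₂ : (w + 2) * (w + 1) / 2 ≡ tri (suc (suc w))
  half₂ = trans (cong₂ (λ x y → x * y / 2) (ℕ.+-comm w 2) (ℕ.+-comm w 1)) (tri-half (suc w))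
  exp₁ : (w + 1) * w / 2 + 2 * i + j * j + 2 * j + 4 * k + 1 ≡ E₁ t
  exp₁ = trans (cong (λ x → x + 2 * i + j * j + 2 * j + 4 * k + 1) half₁) (lemma₁ (tri w) i j k)
  exp₂ : (w + 2) * (w + 1) / 2 + i + j * j + 2 * j + 4 * k + 1 ≡ E₂ t
  exp₂ = trans (cong (λ x → x + i + j * j + 2 * j + 4 * k + 1) half₂) (lemma₂ (tri w) i j k)
  exp₃ : w * (w ∸ 1) / 2 + 3 * i + j * j + 4 * j + 7 * k ≡ E₃ t
  exp₃ = trans (cong (λ x → x + 3 * i + j * j + 4 * j + 7 * k) (half₀ w)) (lemma₃ (tri w) i j k)

-- The series in which both sides of the theorem meet; its summands follow the order of the
-- numerators.
S : ℤ⟦x,q⟧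
S m n = piece (1 ∷ []) 2 B m n ℤ.+ piece (1 ∷ 1 ∷ []) 2 C m n ℤ.+ piece [] 2 B m n

hasSum-triples : HasSum U tripleTerm S
hasSum-triples m n = box m , box-unique m , All.universal (λ _ → tt) (box m) , outside , total
  where
  outside : ∀ t → U t → t ∉ box m → tripleTerm t m n ≡ 0ℤ
  outside t _ t∉ = trans (tripleTerm-split t m n) (cong₂ ℤ._+_ (cong₂ ℤ._+_
    (vanish 1 E₁) (vanish 2 E₂)) (vanish 0 E₃))
    where
    vanish : ∀ c (e : Triple → ℕ) → monomialTerm c e t m n ≡ 0ℤ
    vanish c e = x^q^-≢ (c + weight t) (e t) m (R t) n
      (λ w≡m → t∉ (weight≤⇒∈box t (subst (weight t ≤_) w≡m (ℕ.m≤n+m (weight t) c))))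
  part : ∀ c (e : Triple → ℕ) a (e′ : Triple → ℕ) →
    (∀ t → e t ≡ a + 2 * weight t + (tri (weight t) + e′ t)) →
    Σℤ (box m) (λ t → monomialTerm c e t m n) ≡
    shift c (λ N → shift (a + 2 * N) (λ r → W N (λ t → shift (tri N + e′ t) (R t) r)) n) m
  part c e a e′ p = trans (Σ-monomialTerm c e m n) (shift-cong c (λ N →
    W-shift N (a + 2 * N) e (λ t → tri N + e′ t) n (λ { t refl → p t })) m)
  total : Σℤ (box m) (λ t → tripleTerm t m n) ≡ S m n
  total = begin
    Σℤ (box m) (λ t → tripleTerm t m n)
      ≡⟨ Σ-cong (box m) (λ t _ → tripleTerm-split t m n) ⟩
    Σℤ (box m) (λ t → T₁ t ℤ.+ T₂ t ℤ.+ T₃ t)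
      ≡⟨ Σ-+ (box m) (λ t → T₁ t ℤ.+ T₂ t) T₃ ⟩
    Σℤ (box m) (λ t → T₁ t ℤ.+ T₂ t) ℤ.+ Σℤ (box m) T₃
      ≡⟨ cong (ℤ._+ Σℤ (box m) T₃) (Σ-+ (box m) T₁ T₂) ⟩
    Σℤ (box m) T₁ ℤ.+ Σℤ (box m) T₂ ℤ.+ Σℤ (box m) T₃
      ≡⟨ cong₂ ℤ._+_ (cong₂ ℤ._+_ (part 1 E₁ 1 e₀ (λ _ → refl)) (part 2 E₂ 2 e₁ (λ _ → refl)))
                     (part 0 E₃ 0 e₀ (λ _ → refl)) ⟩
    S m n ∎
    where
    open ≡-Reasoning
    T₁ T₂ T₃ : Triple → ℤ
    T₁ t = monomialTerm 1 E₁ t m n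
    T₂ t = monomialTerm 2 E₂ t m n
    T₃ t = monomialTerm 0 E₃ t m n

-- Condition(1) as a condition on consecutive parts

-- For x ≤ y ≤ z, the case of Condition(1) at distance two: of the triples
-- with z ≤ x + 1, only x, x, x + 1 has sum ≡ 1 (mod 3).
Triad : ℕ → ℕ → ℕ → Set
Triad x y z = 2 + x ≤ z ⊎ (y ≡ x × z ≡ suc x)

-- Collects the constraints between `x` and the up to three parts after it, so that Condition(1)
-- becomes a recursion along the list. The clauses differ in how many of these parts exist.
Fits : ℕ → List ℕ → Set
Fits x []              = ⊤
Fits x (y ∷ [])        = x ≤ y
Fits x (y ∷ z ∷ [])    = x ≤ y × Triad x y z
Fits x (y ∷ z ∷ w ∷ _) = x ≤ y × Triad x y z × 3 + x ≤ w

Chain : List ℕ → Set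
Chain []      = ⊤
Chain (x ∷ π) = Fits x π × Chain π

Good : List ℕ → Set
Good π = All (1 ≤_) π × Chain π

-- On Good lists: 1 occurs at most once.
Second≥2 : List ℕ → Set
Second≥2 []          = ⊤
Second≥2 (_ ∷ [])    = ⊤
Second≥2 (_ ∷ y ∷ _) = 2 ≤ y

Good₁ : List ℕ → Set
Good₁ π = Good π × Second≥2 π

3∤3x∸1 : ∀ x → ¬ (ℤ.+ 3 ℤ.∣ (ℤ.+ (x + x + x) ℤ.- 1ℤ))
-- Divisibility of integers is that of absolute values: here -1 becomes 1. For positive `x` the
-- subtraction merely removes a successor.
3∤3x∸1 zero    d = >⇒∤ (s<s z<s) d
3∤3x∸1 (suc x) d = >⇒∤ (s<s (s<s z<s)) (∣m+n∣m⇒∣n (subst (3 ∣_) (lemma x) d) (m∣m*n x))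
  where
  lemma : ∀ x → x + (1 + x) + (1 + x) ≡ 3 * x + 2
  lemma = ℕ-Solver.solve-∀

3∤3x+1 : ∀ x → ¬ (ℤ.+ 3 ℤ.∣ (ℤ.+ (x + suc x + suc x) ℤ.- 1ℤ))
3∤3x+1 x d = >⇒∤ (s<s z<s) (∣m+n∣m⇒∣n (subst (3 ∣_) lemma′ d) (m∣m*n x))
  where
  lemma : ∀ x → x + (1 + x) + (1 + x) ≡ 1 + (3 * x + 1)
  lemma = ℕ-Solver.solve-∀
  lemma′ : ℤ.∣ ℤ.+ (x + suc x + suc x) ℤ.- 1ℤ ∣ ≡ 3 * x + 1
  lemma′ rewrite lemma x = refl

3∣3x : ∀ x → ℤ.+ 3 ℤ.∣ (ℤ.+ (x + x + suc x) ℤ.- 1ℤ)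
3∣3x x = subst (3 ∣_) (sym lemma′) (m∣m*n x)
  where
  lemma : ∀ x → x + x + (1 + x) ≡ 1 + 3 * x
  lemma = ℕ-Solver.solve-∀
  lemma′ : ℤ.∣ ℤ.+ (x + x + suc x) ℤ.- 1ℤ ∣ ≡ 3 * x
  lemma′ rewrite lemma x = refl

Condition₂ : ℕ → ℕ → ℕ → Set
Condition₂ x y z = z ∸ x ≤ 1 → ℤ.+ 3 ℤ.∣ (ℤ.+ (x + y + z) ℤ.- 1ℤ)

triad⇒condition₂ : ∀ x y z → Triad x y z → Condition₂ x y z
triad⇒condition₂ x y z (inj₁ 2+x≤z)        z∸x≤1 =
  contradiction (ℕ.≤-trans (ℕ.m+n≤o⇒m≤o∸n 2 2+x≤z) z∸x≤1) λ { (s≤s ()) }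
triad⇒condition₂ x y z (inj₂ (refl , refl)) _     = 3∣3x x

-- If z ≤ x + 1, the possibilities are x, x, x and x, x, x+1 and x, x+1, x+1. Their sums less 1 are
-- 3x - 1, 3x and 3x + 1, so divisibility by 3 leaves only the middle one.
condition₂⇒triad : ∀ x y z → x ≤ y → y ≤ z → Condition₂ x y z → Triad x y z
condition₂⇒triad x y z x≤y y≤z c with (2 + x) ℕ.≤? z
... | yes 2+x≤z = inj₁ 2+x≤z
... | no  2+x≰z with ℕ.m≤n⇒m<n∨m≡n x≤y | ℕ.m≤n⇒m<n∨m≡n (ℕ.≤-trans x≤y y≤z)
...   | inj₂ refl | inj₂ refl =
  contradiction (c (ℕ.≤-trans (ℕ.≤-reflexive (ℕ.n∸n≡0 x)) z≤n)) (3∤3x∸1 x)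
...   | inj₂ refl | inj₁ x<z  = inj₂ (refl , ℕ.≤-antisym (s≤s⁻¹ (ℕ.≰⇒> 2+x≰z)) x<z)
...   | inj₁ x<y  | inj₂ refl = contradiction y≤z (ℕ.<⇒≱ x<y)
...   | inj₁ x<y  | inj₁ x<z
  with refl ← ℕ.≤-antisym (s≤s⁻¹ (ℕ.≰⇒> 2+x≰z)) x<z
  with refl ← ℕ.≤-antisym y≤z x<y
  = contradiction (c (ℕ.≤-reflexive (ℕ.m+n∸n≡m 1 x))) (3∤3x+1 x)

Fits⇒≤ : ∀ x y π → Fits x (y ∷ π) → x ≤ y
Fits⇒≤ x y []          f = f
Fits⇒≤ x y (_ ∷ [])    f = proj₁ f
Fits⇒≤ x y (_ ∷ _ ∷ _) f = proj₁ f

Chain⇒Linked : ∀ π → Chain π → Linked _≤_ π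
Chain⇒Linked []          c       = []
Chain⇒Linked (x ∷ [])    c       = [-]
Chain⇒Linked (x ∷ y ∷ π) (f , c) = Fits⇒≤ x y π f ∷ Chain⇒Linked (y ∷ π) c

Fits⇒Triad : ∀ x y z π → Fits x (y ∷ z ∷ π) → Triad x y z
Fits⇒Triad x y z []      (_ , t)     = t
Fits⇒Triad x y z (_ ∷ _) (_ , t , _) = t

Chain⇒Condition : ∀ π → Chain π → Condition 1ℤ π
Chain⇒Condition π c = distance₃ π c , distance₂ π c
  where
  distance₃ : ∀ π → Chain π → (i l : Fin (length π)) → toℕ l ≡ toℕ i + 3 →
              lookup π l ∸ lookup π i ≥ 3
  distance₃ (x ∷ π) (_ , c) (suc i) (suc l) eq = distance₃ π c i l (ℕ.suc-injective eq)
  distance₃ (x ∷ y ∷ z ∷ w ∷ π) ((_ , _ , 3+x≤w) , _) zero (suc (suc (suc zero))) _ =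
    ℕ.m+n≤o⇒m≤o∸n 3 3+x≤w
  distance₂ : ∀ π → Chain π → (i j k : Fin (length π)) →
              toℕ j ≡ toℕ i + 1 → toℕ k ≡ toℕ i + 2 →
              Condition₂ (lookup π i) (lookup π j) (lookup π k)
  distance₂ (x ∷ π) (_ , c) (suc i) (suc j) (suc k) p r =
    distance₂ π c i j k (ℕ.suc-injective p) (ℕ.suc-injective r)
  distance₂ (x ∷ y ∷ z ∷ π) (f , _) zero (suc zero) (suc (suc zero)) _ _ =
    triad⇒condition₂ x y z (Fits⇒Triad x y z π f)

Condition⇒Chain : ∀ π → Linked _≤_ π → Condition 1ℤ π → Chain π
Condition⇒Chain []      _ _         = tt
Condition⇒Chain (x ∷ π) l (c₃ , c₂) = fits π l c₃ c₂ , Condition⇒Chain π (tail l)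
  ( (λ i l eq → c₃ (suc i) (suc l) (cong suc eq))
  , (λ i j k p r → c₂ (suc i) (suc j) (suc k) (cong suc p) (cong suc r)) )
  where
  tail : ∀ {x π} → Linked _≤_ (x ∷ π) → Linked _≤_ π
  tail [-]     = []
  tail (_ ∷ l) = l
  fits : ∀ π → Linked _≤_ (x ∷ π) → let ξ = x ∷ π in
    (∀ (i l : Fin (length ξ)) → toℕ l ≡ toℕ i + 3 → lookup ξ l ∸ lookup ξ i ≥ 3) →
    (∀ (i j k : Fin (length ξ)) → toℕ j ≡ toℕ i + 1 → toℕ k ≡ toℕ i + 2 →
      Condition₂ (lookup ξ i) (lookup ξ j) (lookup ξ k)) → Fits x π
  fits []          l              c₃ c₂ = tt
  fits (y ∷ [])    (x≤y ∷ _)       c₃ c₂ = x≤y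
  fits (y ∷ z ∷ []) (x≤y ∷ y≤z ∷ _) c₃ c₂ =
    x≤y , condition₂⇒triad x y z x≤y y≤z (c₂ zero (suc zero) (suc (suc zero)) refl refl)
  fits (y ∷ z ∷ w ∷ π) (x≤y ∷ y≤z ∷ z≤w ∷ _) c₃ c₂ =
    x≤y , condition₂⇒triad x y z x≤y y≤z (c₂ zero (suc zero) (suc (suc zero)) refl refl)
    , ℕ.m≤o∸n⇒m+n≤o 3 (ℕ.≤-trans x≤y (ℕ.≤-trans y≤z z≤w)) (c₃ zero (suc (suc (suc zero))) refl)

-- Adding a constant to every part

lift : ℕ → List ℕ → List ℕ
lift k = map (k +_)

shuffle : ∀ a k x → a + (k + x) ≡ k + (a + x)
shuffle = ℕ-Solver.solve-∀

lift-≤⁺ : ∀ a k {x y} → a + x ≤ y → a + (k + x) ≤ k + y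
lift-≤⁺ a k {x} {y} p = subst (_≤ k + y) (sym (shuffle a k x)) (ℕ.+-monoʳ-≤ k p)

lift-≤⁻ : ∀ a k {x y} → a + (k + x) ≤ k + y → a + x ≤ y
lift-≤⁻ a k {x} {y} p = ℕ.+-cancelˡ-≤ k _ _ (subst (_≤ k + y) (shuffle a k x) p)

-- Both alternatives depend on differences only; modulo 3 this reflects that the sum of three parts
-- changes by 3k.
Triad-lift⁺ : ∀ k {x y z} → Triad x y z → Triad (k + x) (k + y) (k + z)
Triad-lift⁺ k     (inj₁ p)             = inj₁ (lift-≤⁺ 2 k p)
Triad-lift⁺ k {x} (inj₂ (refl , refl)) = inj₂ (refl , ℕ.+-suc k x)

Triad-lift⁻ : ∀ k {x y z} → Triad (k + x) (k + y) (k + z) → Triad x y z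
Triad-lift⁻ k     (inj₁ p)       = inj₁ (lift-≤⁻ 2 k p)
Triad-lift⁻ k {x} (inj₂ (p , r)) =
  inj₂ (ℕ.+-cancelˡ-≡ k _ _ p , ℕ.+-cancelˡ-≡ k _ _ (trans r (sym (ℕ.+-suc k x))))

Fits-lift⁺ : ∀ k x π → Fits x π → Fits (k + x) (lift k π)
Fits-lift⁺ k x []              f           = tt
Fits-lift⁺ k x (y ∷ [])        f           = lift-≤⁺ 0 k f
Fits-lift⁺ k x (y ∷ z ∷ [])    (f , t)     = lift-≤⁺ 0 k f , Triad-lift⁺ k t
Fits-lift⁺ k x (y ∷ z ∷ w ∷ _) (f , t , g) = lift-≤⁺ 0 k f , Triad-lift⁺ k t , lift-≤⁺ 3 k g

Fits-lift⁻ : ∀ k x π → Fits (k + x) (lift k π) → Fits x π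
Fits-lift⁻ k x []              f           = tt
Fits-lift⁻ k x (y ∷ [])        f           = lift-≤⁻ 0 k f
Fits-lift⁻ k x (y ∷ z ∷ [])    (f , t)     = lift-≤⁻ 0 k f , Triad-lift⁻ k t
Fits-lift⁻ k x (y ∷ z ∷ w ∷ _) (f , t , g) = lift-≤⁻ 0 k f , Triad-lift⁻ k t , lift-≤⁻ 3 k g

Chain-lift⁺ : ∀ k π → Chain π → Chain (lift k π)
Chain-lift⁺ k []      c       = tt
Chain-lift⁺ k (x ∷ π) (f , c) = Fits-lift⁺ k x π f , Chain-lift⁺ k π c

Chain-lift⁻ : ∀ k π → Chain (lift k π) → Chain π
Chain-lift⁻ k []      c       = tt
Chain-lift⁻ k (x ∷ π) (f , c) = Fits-lift⁻ k x π f , Chain-lift⁻ k π c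

lift-lower : ∀ k {π} → All (1 ≤_) π → All (suc k ≤_) (lift k π)
lift-lower k p = All.map⁺
  (All.map (λ {x} 1≤x → subst (_≤ k + x) (ℕ.+-comm k 1) (ℕ.+-monoʳ-≤ k 1≤x)) p)

lift-positive : ∀ k {π} → All (1 ≤_) π → All (1 ≤_) (lift k π)
lift-positive k p = All.map (ℕ.≤-trans (s≤s z≤n)) (lift-lower k p)

lower : ∀ k π → All (suc k ≤_) π → Chain π → ∃[ ρ ] Good ρ × π ≡ lift k ρ
lower k π bound c with preimage π bound
  where
  preimage : ∀ π → All (suc k ≤_) π → ∃[ ρ ] All (1 ≤_) ρ × π ≡ lift k ρ
  preimage []      []      = [] , [] , refl
  preimage (x ∷ π) (p ∷ b) with preimage π b
  ... | ρ , b′ , refl = x ∸ k ∷ ρ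
                      , ℕ.m<n⇒0<n∸m p ∷ b′
                      , cong (_∷ lift k ρ) (sym (ℕ.m+[n∸m]≡n (ℕ.<⇒≤ p)))
... | ρ , b , refl = ρ , (b , Chain-lift⁻ k ρ c) , refl

Chain⇒All : ∀ x π → Chain (x ∷ π) → All (x ≤_) π
Chain⇒All x []      c       = []
Chain⇒All x (y ∷ π) (f , c) =
  Fits⇒≤ x y π f ∷ All.map (ℕ.≤-trans (Fits⇒≤ x y π f)) (Chain⇒All y π c)

bounded : ∀ {k x} π → k ≤ x → Chain (x ∷ π) → All (k ≤_) (x ∷ π)
bounded {x = x} π k≤x c = k≤x ∷ All.map (ℕ.≤-trans k≤x) (Chain⇒All x π c)

-- Removing and adding small parts

-- The combinatorial counterpart of `piece`.
Piece : List ℕ → ℕ → (List ℕ → Set) → List ℕ → Set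
Piece pre k Q π = ∃[ ρ ] Q ρ × π ≡ pre ++ lift k ρ

-- The first part decides: if it exceeds 1, all parts can be lowered by 1; if it is 1, all others
-- are at least 2 and can be lowered.
Good₁⁻ : ∀ π → Good₁ π → Piece [] 1 Good π ⊎ Piece (1 ∷ []) 1 Good₁ π
Good₁⁻ []                _ = inj₁ ([] , ([] , tt) , refl)
Good₁⁻ (zero ∷ _)        ((() ∷ _ , _) , _)
Good₁⁻ (suc (suc x) ∷ π) ((_ , c) , _) = inj₁ (lower 1 _ (bounded π (s≤s (s≤s z≤n)) c) c)
Good₁⁻ (1 ∷ [])          _ = inj₂ ([] , (([] , tt) , tt) , refl)
Good₁⁻ (1 ∷ y ∷ π)       ((_ , f , c) , 2≤y) with lower 1 (y ∷ π) (bounded π 2≤y c) c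
... | a ∷ []    , g             , refl = inj₂ (_ , (g , tt) , refl)
... | a ∷ b ∷ ρ , g@(1≤a ∷ _ , _) , refl with Fits⇒Triad 1 (suc a) (suc b) (lift 1 ρ) f
-- The third part is at least 3, so after lowering, 1 again occurs at most once. The other
-- alternative would make the second part 1.
...   | inj₁ 3≤1+b      = inj₂ (_ , (g , s≤s⁻¹ 3≤1+b) , refl)
...   | inj₂ (refl , _) = contradiction 1≤a λ ()

-- Three equal parts are excluded, so the third exceeds the first. This yields the distance-three
-- bound for a small part placed directly before a lifted partition.
third≥2 : ∀ {x y z} → 1 ≤ x → Triad x y z → 2 ≤ z
third≥2 1≤x (inj₁ 2+x≤z)       = ℕ.≤-trans (s≤s (s≤s z≤n)) 2+x≤z
third≥2 1≤x (inj₂ (_ , refl)) = s≤s 1≤x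

third≥3 : ∀ {x y z} → 1 ≤ x → 2 ≤ y → Triad x y z → 3 ≤ z
third≥3 1≤x 2≤y (inj₁ 2+x≤z)          = ℕ.≤-trans (s≤s (s≤s 1≤x)) 2+x≤z
third≥3 1≤x 2≤y (inj₂ (refl , refl)) = s≤s 2≤y

Good₁⁺ˡ : ∀ ρ → Good ρ → Good₁ (lift 1 ρ)
Good₁⁺ˡ ρ (p , c) = (lift-positive 1 p , Chain-lift⁺ 1 ρ c) , second ρ p
  where
  second : ∀ ρ → All (1 ≤_) ρ → Second≥2 (lift 1 ρ)
  second []          _           = tt
  second (_ ∷ [])    _           = tt
  second (_ ∷ _ ∷ _) (_ ∷ p ∷ _) = s≤s p

Good₁⁺ʳ : ∀ ρ → Good₁ ρ → Good₁ (1 ∷ lift 1 ρ)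
Good₁⁺ʳ ρ g@((p , c) , _) = (s≤s z≤n ∷ lift-positive 1 p , fits ρ g , Chain-lift⁺ 1 ρ c)
                               , second ρ p
  where
  second : ∀ ρ → All (1 ≤_) ρ → Second≥2 (1 ∷ lift 1 ρ)
  second []      _       = tt
  second (_ ∷ _) (p ∷ _) = s≤s p
  fits : ∀ ρ → Good₁ ρ → Fits 1 (lift 1 ρ)
  fits []              _         = tt
  fits (y ∷ [])        _         = s≤s z≤n
  fits (y ∷ z ∷ [])    (_ , 2≤z) = s≤s z≤n , inj₁ (s≤s 2≤z)
  fits (y ∷ z ∷ w ∷ ρ) ((1≤y ∷ _ , f , _) , 2≤z) =
    s≤s z≤n , inj₁ (s≤s 2≤z) , s≤s (third≥3 1≤y 2≤z (Fits⇒Triad y z w ρ f))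

-- Unless the second part is at least 2, the partition begins 1, 1. The triad condition then makes
-- the next part, if any, at least 3 or equal to 2.
Good⁻ : ∀ π → Good π →
  Good₁ π ⊎ Piece (1 ∷ 1 ∷ []) 2 Good₁ π ⊎ Piece (1 ∷ 1 ∷ 2 ∷ []) 3 Good π
Good⁻ []       g = inj₁ (g , tt)
Good⁻ (_ ∷ []) g = inj₁ (g , tt)
Good⁻ (_ ∷ zero ∷ _)        ((_ ∷ () ∷ _) , _)
Good⁻ (_ ∷ suc (suc _) ∷ _) g = inj₁ (g , s≤s (s≤s z≤n))
Good⁻ (zero ∷ 1 ∷ _)        ((() ∷ _) , _)
Good⁻ (suc (suc x) ∷ 1 ∷ π) (_ , f , _) =
  contradiction (Fits⇒≤ (suc (suc x)) 1 π f) λ { (s≤s ()) }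
Good⁻ (1 ∷ 1 ∷ [])    _ = inj₂ (inj₁ ([] , (([] , tt) , tt) , refl))
Good⁻ (1 ∷ 1 ∷ z ∷ π) (_ , f , f′ , c) with Fits⇒Triad 1 1 z π f
... | inj₁ 3≤z with lower 2 (z ∷ π) (bounded π 3≤z c) c
...   | a ∷ []    , g , refl = inj₂ (inj₁ (_ , (g , tt) , refl))
-- The fourth part is at least 4, by distance three from the first 1; lowered by 2, it is at least
-- 2, as `Good₁` demands.
...   | a ∷ b ∷ ρ , g , refl = inj₂ (inj₁ (_ , (g , s≤s⁻¹ (s≤s⁻¹ (proj₂ (proj₂ f)))) , refl))
Good⁻ (1 ∷ 1 ∷ z ∷ [])     _ | inj₂ (_ , refl) = inj₂ (inj₂ ([] , ([] , tt) , refl))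
-- After 1, 1, 2 the distance-three bound forces `4 ≤ w`, so the rest can be lowered by 3.
Good⁻ (1 ∷ 1 ∷ z ∷ w ∷ π) (_ , f , f′ , _ , c) | inj₂ (_ , refl)
  with lower 3 (w ∷ π) (bounded π (proj₂ (proj₂ f)) c) c
... | ρ , g , eq = inj₂ (inj₂ (ρ , g , cong (λ π → 1 ∷ 1 ∷ 2 ∷ π) eq))

-- The first 1 needs `4 ≤ 2 + z` for the second part `z` of `ρ`. This is why C, and not B,
-- accompanies the prefix 1+1.
Good₁-fits₁ : ∀ ρ → Good₁ ρ → Fits 1 (1 ∷ lift 2 ρ)
Good₁-fits₁ []          _         = s≤s z≤n
Good₁-fits₁ (y ∷ [])    (((1≤y ∷ _) , _) , _) = s≤s z≤n , inj₁ (s≤s (s≤s 1≤y))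
Good₁-fits₁ (y ∷ z ∷ _) (((1≤y ∷ _) , _) , 2≤z) =
  s≤s z≤n , inj₁ (s≤s (s≤s 1≤y)) , s≤s (s≤s 2≤z)

Good-fits₁ : ∀ ρ → Good ρ → Fits 1 (lift 2 ρ)
Good-fits₁ []              _                   = tt
Good-fits₁ (y ∷ [])        _                   = s≤s z≤n
Good-fits₁ (y ∷ z ∷ [])    ((_ ∷ 1≤z ∷ _) , _) = s≤s z≤n , inj₁ (s≤s (s≤s 1≤z))
Good-fits₁ (y ∷ z ∷ w ∷ ρ) ((1≤y ∷ 1≤z ∷ _) , f , _) =
  s≤s z≤n , inj₁ (s≤s (s≤s 1≤z)) , s≤s (s≤s (third≥2 1≤y (Fits⇒Triad y z w ρ f)))

Good⁺² : ∀ ρ → Good ρ → Good (lift 2 ρ)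
Good⁺² ρ (p , c) = lift-positive 2 p , Chain-lift⁺ 2 ρ c

Good⁺¹² : ∀ ρ → Good ρ → Good (1 ∷ lift 2 ρ)
Good⁺¹² ρ g@(p , c) = (s≤s z≤n ∷ lift-positive 2 p) , Good-fits₁ ρ g , Chain-lift⁺ 2 ρ c

Good⁺¹¹² : ∀ ρ → Good₁ ρ → Good (1 ∷ 1 ∷ lift 2 ρ)
Good⁺¹¹² ρ g@((p , c) , _) =
  (s≤s z≤n ∷ s≤s z≤n ∷ lift-positive 2 p) ,
  Good₁-fits₁ ρ g , Good-fits₁ ρ (proj₁ g) , Chain-lift⁺ 2 ρ c

-- The triad 1, 1, 2 is the exceptional one of `Triad`. All triads reaching into the lifted part
-- have difference at least 2.
Good⁺¹¹²³ : ∀ ρ → Good ρ → Good (1 ∷ 1 ∷ 2 ∷ lift 3 ρ)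
Good⁺¹¹²³ ρ g@(p , c) =
  (s≤s z≤n ∷ s≤s z≤n ∷ s≤s z≤n ∷ lift-positive 3 p) ,
  fits₁ ρ g , fits₂ ρ g , fits₃ ρ g , Chain-lift⁺ 3 ρ c
  where
  fits₁ : ∀ ρ → Good ρ → Fits 1 (1 ∷ 2 ∷ lift 3 ρ)
  fits₁ []      _                 = s≤s z≤n , inj₂ (refl , refl)
  fits₁ (y ∷ _) ((1≤y ∷ _) , _) = s≤s z≤n , inj₂ (refl , refl) , s≤s (s≤s (s≤s 1≤y))
  fits₂ : ∀ ρ → Good ρ → Fits 1 (2 ∷ lift 3 ρ)
  fits₂ []          _                   = s≤s z≤n
  fits₂ (y ∷ [])    _                   = s≤s z≤n , inj₁ (s≤s (s≤s (s≤s z≤n)))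
  fits₂ (y ∷ z ∷ _) ((_ ∷ 1≤z ∷ _) , _) =
    s≤s z≤n , inj₁ (s≤s (s≤s (s≤s z≤n))) , s≤s (s≤s (s≤s 1≤z))
  fits₃ : ∀ ρ → Good ρ → Fits 2 (lift 3 ρ)
  fits₃ []              _                   = tt
  fits₃ (y ∷ [])        _                   = s≤s (s≤s z≤n)
  fits₃ (y ∷ z ∷ [])    ((_ ∷ 1≤z ∷ _) , _) = s≤s (s≤s z≤n) , inj₁ (s≤s (s≤s (s≤s 1≤z)))
  fits₃ (y ∷ z ∷ w ∷ ρ) ((1≤y ∷ 1≤z ∷ _) , f , _) =
    s≤s (s≤s z≤n) , inj₁ (s≤s (s≤s (s≤s 1≤z)))
    , s≤s (s≤s (s≤s (third≥2 1≤y (Fits⇒Triad y z w ρ f))))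

-- Partitions in which 2 does not occur

NoTwo : List ℕ → Set
NoTwo π = Good π × 2 ∉ π

-- Sorted by the number of 1s, which is at most two; the remaining parts are at least 3 and can be
-- lowered by 2. For two 1s the split of `Good⁻` is reused, its prefix 1, 1, 2 being excluded.
NoTwo⁻ : ∀ π → NoTwo π →
  Piece (1 ∷ []) 2 Good π ⊎ Piece (1 ∷ 1 ∷ []) 2 Good₁ π ⊎ Piece [] 2 Good π
NoTwo⁻ []                          _ = inj₂ (inj₂ ([] , ([] , tt) , refl))
NoTwo⁻ (zero ∷ _)                  (((() ∷ _) , _) , _)
NoTwo⁻ (2 ∷ π)                     (_ , 2∉) = contradiction (here refl) 2∉
NoTwo⁻ (suc (suc (suc x)) ∷ π)     ((_ , c) , _) =
  inj₂ (inj₂ (lower 2 _ (bounded π (s≤s (s≤s (s≤s z≤n))) c) c))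
NoTwo⁻ (1 ∷ [])                    _ = inj₁ ([] , ([] , tt) , refl)
NoTwo⁻ (1 ∷ zero ∷ _)              (((_ ∷ () ∷ _) , _) , _)
NoTwo⁻ (1 ∷ 2 ∷ π)                 (_ , 2∉) = contradiction (there (here refl)) 2∉
NoTwo⁻ (1 ∷ suc (suc (suc x)) ∷ π) ((_ , f , c) , _)
  with lower 2 _ (bounded π (s≤s (s≤s (s≤s z≤n))) c) c
... | ρ , g , eq = inj₁ (ρ , g , cong (1 ∷_) eq)
NoTwo⁻ (1 ∷ 1 ∷ π)                 (g , 2∉) with Good⁻ (1 ∷ 1 ∷ π) g
... | inj₁ (_ , s≤s ())
... | inj₂ (inj₁ p) = inj₂ (inj₁ p)
... | inj₂ (inj₂ (ρ , _ , refl)) = contradiction (there (there (here refl))) 2∉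

2∉lift : ∀ {π} → All (1 ≤_) π → 2 ∉ lift 2 π
2∉lift p 2∈ = contradiction (All.lookup (lift-lower 2 p) 2∈) λ { (s≤s (s≤s ())) }

2∉1∷ : ∀ {π} → 2 ∉ π → 2 ∉ 1 ∷ π
2∉1∷ 2∉ (there 2∈) = 2∉ 2∈

NoTwo⇔𝒫 : ∀ {π} → (NoTwo π → 𝒫 π) × (𝒫 π → NoTwo π)
NoTwo⇔𝒫 {π} =
  (λ ((p , c) , 2∉) → (Chain⇒Linked π c , p) , Chain⇒Condition π c , 2∉) ,
  (λ ((l , p) , c , 2∉) → (p , Condition⇒Chain π l c) , 2∉)

-- Counting partitions

-- A complete list without repetitions witnesses that `v` is the number of elements; `v` is an
-- integer so that it can be a coefficient.
Counted : {A : Set} → (A → Set) → ℤ → Set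
Counted P v = ∃[ l ] Unique l × (∀ {x} → x ∈ l → P x) × (∀ {x} → P x → x ∈ l) × ℤ.+ length l ≡ v

counted-∅ : ∀ {P : A → Set} → (∀ {x} → ¬ P x) → Counted P 0ℤ
counted-∅ empty = [] , [] , (λ ()) , (λ p → contradiction p empty) , refl

counted-⇔ : ∀ {P Q : A → Set} {v} → (∀ {x} → P x → Q x) → (∀ {x} → Q x → P x) →
            Counted P v → Counted Q v
counted-⇔ f g (l , u , s , c , e) = l , u , f ∘ s , c ∘ g , e

counted-⊎ : ∀ {P Q : A → Set} {u v} → (∀ {x} → P x → ¬ Q x) →
            Counted P u → Counted Q v → Counted (λ x → P x ⊎ Q x) (u ℤ.+ v)
counted-⊎ {P = P} {Q} disjoint (l , u , s , c , refl) (l′ , u′ , s′ , c′ , refl) =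
  l ++ l′ , Unique.++⁺ u u′ (λ (x∈l , x∈l′) → disjoint (s x∈l) (s′ x∈l′)) , sound , complete ,
  cong ℤ.+_ (List.length-++ l)
  where
  sound : ∀ {x} → x ∈ l ++ l′ → P x ⊎ Q x
  sound x∈ with ∈-++⁻ l x∈
  ... | inj₁ x∈l  = inj₁ (s x∈l)
  ... | inj₂ x∈l′ = inj₂ (s′ x∈l′)
  complete : ∀ {x} → P x ⊎ Q x → x ∈ l ++ l′
  complete (inj₁ p) = ∈-++⁺ˡ (c p)
  complete (inj₂ q) = ∈-++⁺ʳ l (c′ q)

counted-map : ∀ {A B : Set} {P : A → Set} {v} (f : A → B) → (∀ {x y} → f x ≡ f y → x ≡ y) →
              Counted P v → Counted (λ y → ∃[ x ] P x × y ≡ f x) v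
counted-map {P = P} f inj (l , u , s , c , e) =
  map f l , Unique.map⁺ inj u , sound , (λ { (x , p , refl) → ∈-map⁺ f (c p) }) ,
  trans (cong ℤ.+_ (List.length-map f l)) e
  where
  sound : ∀ {y} → y ∈ map f l → ∃[ x ] P x × y ≡ f x
  sound y∈ with ∈-map⁻ f y∈
  ... | x , x∈ , y≡ = x , s x∈ , y≡

-- Below degree `e` the coefficient is 0, and `large` says that nothing is there to count.
counted-shift : ∀ {P : A → Set} e f n →
  (∀ {x} → P x → e ≤ n) → (∀ n′ → e + n′ ≡ n → Counted P (f n′)) → Counted P (shift e f n)
counted-shift zero    f n       large c = c n refl
counted-shift (suc e) f zero    large c = counted-∅ (λ p → contradiction (large p) λ ())
counted-shift (suc e) f (suc n) large c =
  counted-shift e f n (s≤s⁻¹ ∘ large) (λ n′ eq → c n′ (cong suc eq))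

Sized : (List ℕ → Set) → ℕ → ℕ → List ℕ → Set
Sized P N n π = P π × length π ≡ N × sum π ≡ n

sum-lift : ∀ k π → sum (lift k π) ≡ k * length π + sum π
sum-lift k []      = sym (trans (ℕ.+-identityʳ (k * 0)) (ℕ.*-zeroʳ k))
sum-lift k (x ∷ π) = trans (cong (k + x +_) (sum-lift k π)) (rearrange k x (length π) (sum π))
  where
  rearrange : ∀ k x l s → k + x + (k * l + s) ≡ k * (1 + l) + (x + s)
  rearrange = ℕ-Solver.solve-∀

-- The map from `ρ` to `pre ++ lift k ρ` is injective, adds `length pre` parts and, on `N′` parts,
-- raises the sum by `sum pre + k * N′`. These are the two shifts in `piece`.
counted-Piece : ∀ pre k Q (F : ℤ⟦x,q⟧) N n →
  (∀ N′ n′ → length pre + N′ ≡ N → sum pre + k * N′ + n′ ≡ n →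
     Counted (Sized Q N′ n′) (F N′ n′)) →
  Counted (Sized (Piece pre k Q) N n) (piece pre k F N n)
counted-Piece pre k Q F N n count =
  counted-shift (length pre) _ N
    (λ { ((ρ , _ , refl) , refl , _) →
         subst (length pre ≤_) (sym (length-piece ρ)) (ℕ.m≤m+n _ _) })
    λ { N′ refl → counted-shift (sum pre + k * N′) (F N′) n
      (λ { ((ρ , _ , refl) , l , refl) →
           subst (λ x → sum pre + k * x ≤ sum (pre ++ lift k ρ)) (length-ρ ρ l)
             (subst (sum pre + k * length ρ ≤_) (sym (sum-piece ρ)) (ℕ.m≤m+n _ _)) })
      λ { n′ refl → counted-⇔
        (λ { (ρ , (q , refl , refl) , refl) → (ρ , q , refl) , length-piece ρ , sum-piece ρ })
        (λ { ((ρ , q , refl) , l , s) →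
             ρ , (q , length-ρ ρ l , ℕ.+-cancelˡ-≡ (sum pre + k * N′) _ _
               (trans (cong (λ x → sum pre + k * x + sum ρ) (sym (length-ρ ρ l)))
                      (trans (sym (sum-piece ρ)) s))) , refl })
        (counted-map (λ ρ → pre ++ lift k ρ)
          (λ eq → List.map-injective (ℕ.+-cancelˡ-≡ k _ _) (List.++-cancelˡ pre _ _ eq))
          (count N′ n′ refl refl)) } }
  where
  length-piece : ∀ ρ → length (pre ++ lift k ρ) ≡ length pre + length ρ
  length-piece ρ = trans (List.length-++ pre) (cong (length pre +_) (List.length-map _ ρ))
  length-ρ : ∀ ρ {N′} → length (pre ++ lift k ρ) ≡ length pre + N′ → length ρ ≡ N′
  length-ρ ρ l = ℕ.+-cancelˡ-≡ (length pre) _ _ (trans (sym (length-piece ρ)) l)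
  sum-piece : ∀ ρ → sum (pre ++ lift k ρ) ≡ sum pre + k * length ρ + sum ρ
  sum-piece ρ = trans (sum-++ pre (lift k ρ)) (trans (cong (sum pre +_) (sum-lift k ρ))
    (sym (ℕ.+-assoc (sum pre) (k * length ρ) (sum ρ))))

Sized-⊎ : ∀ {P Q T : List ℕ → Set} {N n u v} →
  (∀ π → T π → P π ⊎ Q π) → (∀ {π} → P π → T π) → (∀ {π} → Q π → T π) → (∀ {π} → P π → ¬ Q π) →
  Counted (Sized P N n) u → Counted (Sized Q N n) v → Counted (Sized T N n) (u ℤ.+ v)
Sized-⊎ {P} {Q} {T} {N} {n} split p q disjoint c d = counted-⇔
  (λ { (inj₁ (x , s)) → p x , s ; (inj₂ (x , s)) → q x , s }) join
  (counted-⊎ (λ (x , _) (y , _) → disjoint x y) c d)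
  where
  join : ∀ {π} → Sized T N n π → Sized P N n π ⊎ Sized Q N n π
  join {π} (t , s) with split π t
  ... | inj₁ x = inj₁ (x , s)
  ... | inj₂ y = inj₂ (y , s)

-- Parts of `lift k ρ` exceed `k`. This separates the cases in which the part `k` comes next from
-- those in which it does not.
lift-≢ : ∀ k {ρ σ} → All (1 ≤_) ρ → lift k ρ ≢ k ∷ σ
lift-≢ k {x ∷ ρ} (1≤x ∷ _) eq = ℕ.<⇒≢ (ℕ.m<m+n k 1≤x) (sym (List.∷-injectiveˡ eq))

counted-0 : ∀ {P} → P [] → ∀ n → Counted (Sized P 0 n) (𝟙 n)
counted-0 p zero    = [] ∷ [] , [] ∷ [] , (λ { (here refl) → p , refl , refl }) ,
  (λ { {[]} _ → here refl }) , refl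
counted-0 p (suc n) = counted-∅ λ { {[]} (_ , _ , ()) }

-- Strong induction on the size `n`, for all lengths at once. The equation for B contains C at the
-- same size, so `good₁` is obtained first and used in `good`.
counted-Good : ∀ n N → Counted (Sized Good N n) (B N n) × Counted (Sized Good₁ N n) (C N n)
counted-Good = <-rec _ induct
  where
  induct : ∀ n →
    (∀ {n′} → n′ < n → ∀ N →
       Counted (Sized Good N n′) (B N n′) × Counted (Sized Good₁ N n′) (C N n′)) →
    ∀ N → Counted (Sized Good N n) (B N n) × Counted (Sized Good₁ N n) (C N n)
  -- Length 0 is separate because B(xq) leaves `n` unchanged there; for positive length every piece
  -- lowers it.
  induct n ih zero =
    subst (Counted (Sized Good 0 n)) (sym (proj₁ (BC-0 n))) (counted-0 ([] , tt) n) ,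
    subst (Counted (Sized Good₁ 0 n)) (sym (proj₂ (BC-0 n))) (counted-0 (([] , tt) , tt) n)
  induct n ih (suc N) = good , good₁
    where
    good₁ : Counted (Sized Good₁ (suc N) n) (C (suc N) n)
    good₁ = subst (Counted (Sized Good₁ (suc N) n)) (sym (C-rec (suc N) n))
      (Sized-⊎ Good₁⁻ (λ { (ρ , g , refl) → Good₁⁺ˡ ρ g }) (λ { (ρ , g , refl) → Good₁⁺ʳ ρ g })
        (λ { (ρ , (p , _) , refl) (σ , _ , eq) → lift-≢ 1 p eq })
        (counted-Piece [] 1 Good B (suc N) n
          λ { _ n′ refl refl → proj₁ (ih (ℕ.m<n+m n′ z<s) (suc N)) })
        (counted-Piece (1 ∷ []) 1 Good₁ C (suc N) n
          λ { N′ n′ _ refl → proj₂ (ih (ℕ.m<n+m n′ z<s) N′) }))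
    good : Counted (Sized Good (suc N) n) (B (suc N) n)
    good = subst (Counted (Sized Good (suc N) n))
      (trans (sym (ℤ.+-assoc (C (suc N) n) _ _)) (sym (B-rec (suc N) n)))
      (Sized-⊎ Good⁻ proj₁
        (λ { (inj₁ (ρ , g , refl)) → Good⁺¹¹² ρ g ; (inj₂ (ρ , g , refl)) → Good⁺¹¹²³ ρ g })
        (λ { (_ , s) (inj₁ (_ , _ , refl)) → contradiction s λ { (s≤s ()) }
           ; (_ , s) (inj₂ (_ , _ , refl)) → contradiction s λ { (s≤s ()) } })
        good₁
        (Sized-⊎ (λ _ p → p) inj₁ inj₂
          (λ { (ρ , ((p , _) , _) , refl) (σ , _ , eq) →
               lift-≢ 2 p (List.∷-injectiveʳ (List.∷-injectiveʳ eq)) })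
          (counted-Piece (1 ∷ 1 ∷ []) 2 Good₁ C (suc N) n
            λ { N′ n′ _ refl → proj₂ (ih (ℕ.m<n+m n′ z<s) N′) })
          (counted-Piece (1 ∷ 1 ∷ 2 ∷ []) 3 Good B (suc N) n
            λ { N′ n′ _ refl → proj₁ (ih (ℕ.m<n+m n′ z<s) N′) })))

counted-NoTwo : ∀ N n → Counted (Sized NoTwo N n) (S N n)
counted-NoTwo N n = subst (Counted (Sized NoTwo N n))
  (sym (ℤ.+-assoc (piece (1 ∷ []) 2 B N n) _ _))
  (Sized-⊎ NoTwo⁻
    (λ { (ρ , g , refl) → Good⁺¹² ρ g , 2∉1∷ (2∉lift (proj₁ g)) })
    (λ { (inj₁ (ρ , g , refl)) → Good⁺¹¹² ρ g , 2∉1∷ (2∉1∷ (2∉lift (proj₁ (proj₁ g))))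
       ; (inj₂ (ρ , g , refl)) → Good⁺² ρ g , 2∉lift (proj₁ g) })
    (λ { ([] , _ , refl) (inj₁ (_ , _ , ())) ; (_ ∷ _ , _ , refl) (inj₁ (_ , _ , ()))
       ; (_ , _ , refl) (inj₂ ([] , _ , ())) ; (_ , _ , refl) (inj₂ (_ ∷ _ , _ , ())) })
    (counted-Piece (1 ∷ []) 2 Good B N n λ N′ n′ _ _ → proj₁ (counted-Good n′ N′))
    (Sized-⊎ (λ _ p → p) inj₁ inj₂
      (λ { (_ , _ , refl) ([] , _ , ()) ; (_ , _ , refl) (_ ∷ _ , _ , ()) })
      (counted-Piece (1 ∷ 1 ∷ []) 2 Good₁ C N n λ N′ n′ _ _ → proj₂ (counted-Good n′ N′))
      (counted-Piece [] 2 Good B N n λ N′ n′ _ _ → proj₁ (counted-Good n′ N′))))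

-- The sum over partitions

partitionTerm-≡ : ∀ π {m n} → length π ≡ m → sum π ≡ n → partitionTerm π m n ≡ 1ℤ
partitionTerm-≡ π refl refl
  rewrite dec-true (length π ℕ.≟ length π) refl | dec-true (sum π ℕ.≟ sum π) refl = refl

partitionTerm-≢ : ∀ π m n → ¬ (length π ≡ m × sum π ≡ n) → partitionTerm π m n ≡ 0ℤ
partitionTerm-≢ π m n ≢ with length π ℕ.≟ m
... | no  l≢m rewrite dec-false (length π ℕ.≟ m) l≢m = refl
... | yes l≡m rewrite dec-true (length π ℕ.≟ m) l≡m
                    | dec-false (sum π ℕ.≟ n) (λ s≡n → ≢ (l≡m , s≡n)) = refl

-- At each monomial the list from `counted-NoTwo` serves as support: its members contribute 1 each
-- and all other partitions 0.
hasSum-partitions : HasSum 𝒫 partitionTerm S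
hasSum-partitions m n with counted-NoTwo m n
... | l , u , sound , complete , total =
  l , u , All.tabulate (λ π∈ → proj₁ NoTwo⇔𝒫 (proj₁ (sound π∈))) ,
  (λ π p π∉ → partitionTerm-≢ π m n (λ s → π∉ (complete (proj₂ NoTwo⇔𝒫 p , s)))) ,
  trans (trans (Σ-cong l (λ π π∈ → let _ , p , r = sound π∈ in partitionTerm-≡ π p r)) (ones l))
        total
  where
  ones : ∀ (l : List A) → Σℤ l (λ _ → 1ℤ) ≡ ℤ.+ length l
  ones []      = refl
  ones (_ ∷ l) = cong (ℤ._+_ 1ℤ) (ones l)

mainTheorem9 : ∃[ S ] (HasSum 𝒫 partitionTerm S × HasSum U tripleTerm S)
mainTheorem9 = S , hasSum-partitions , hasSum-triples
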